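{- On HDAs over $\Sigma$, hhp-bisimilarity is strictly contained in hqhp-bisimilarity: ${\underline{\leftrightarrow}_{hhp}}\subsetneq{\underline{\leftrightarrow}_{hqhp}}$.
   Context: HDAs. $\Sigma$ is a fixed set of actions, containing pairwise distinct actions $a,b,c,d$. A conclist is $U=(n,\lambda)$ with $n\in\mathbb N$ and $\lambda:\{1<\dots<n\}\to\Sigma$. The category $\square$ has conclists as objects; a morphism $(m,\lambda)\to(n,\mu)$ is a pair $(f,\varepsilon)$ with $f:\{1,\dots,m\}\to\{1,\dots,n\}$ injective, order- and label-preserving, and $\varepsilon:\{1,\dots,n\}\to\{0,*,1\}$ with $\varepsilon^{ -1}(*)=\mathrm{im} f$; composition is $(g,\zeta)\circ(f,\varepsilon)=(g\circ f,\eta)$ with $\eta(g(t))=\varepsilon(t)$ and $\eta(u)=\zeta(u)$ for $u\notin\mathrm{im}\,g$. For $1\le i\le n$, $k\in\{0,1\}$, the coface map $d_i^k:U\to V$ ($V$ of dimension $n$, $U$ of dimension $n-1$) has $f$ omitting position $i$, $\varepsilon(i)=k$, and $\varepsilon(j)=*$ for $j\ne i$. A precubical set is a functor $X:\square^{op}\to\mathbf{Set}$; elements of $X[U]$, $U=(n,\lambda)$, are $n$-dimensional cells, and $\delta_i^k:=X[d_i^k]$. An HDA is a pair $(X,i)$ of a precubical set and an initial $0$-dimensional cell $i$. Paths. A path of an HDA $\mathcal X$ is a sequence $\alpha=(x_0,\varphi_1,x_1,\dots,\varphi_n,x_n)$ ($n\ge 0$) with $x_0$ the initial cell, $x_j\in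 X[U_j]$, where for each $j$ either $\varphi_j=d^0_{i_j}:U_{j-1}\to U_j$ with $x_{j-1}=\delta^0_{i_j}(x_j)$ (up-step, starting an event) or $\varphi_j=d^1_{i_j}:U_j\to U_{j-1}$ with $x_j=\delta^1_{i_j}(x_{j-1})$ (down-step, ending an event). $\alpha\hookrightarrow\alpha'$ means $\alpha$ is a prefix of $\alpha'$. $\alpha\leftrightarrows^\ell\beta$ ($\ell$-similarity): one of $\alpha,\beta$ is obtained from the other by replacing, around the cell $x_\ell$, $(d_i^0,x_\ell,d_j^0)$ by $(d_{j-1}^0,x'_\ell,d_i^0)$, or $(d_j^1,x_\ell,d_i^1)$ by $(d_i^1,x'_\ell,d_{j-1}^1)$, for some $i<j$ and some cell $x'_\ell$. $\alpha\sqsubseteq^\ell\beta$ ($\beta$ subsumes $\alpha$ at $\ell$): $\alpha$ is obtained from $\beta$ by replacing, around $x_\ell$, $(d_i^0,x_\ell,d_j^1)$ by $(d_{j-1}^1,x'_\ell,d_i^0)$, or $(d_j^0,x_\ell,d_i^1)$ by $(d_i^1,x'_\ell,d_{j-1}^0)$, for some $i<j$. ST-traces. Given a down-step at position $p$ of a path, move it to the left: as long as the step directly before it is a down-step, or an up-step whose index differs from the current index of the moving down-step, there is a unique replacement moving it one position left: for some $i<j$ and cells $x,x'$, it replaces $(d_j^1,x,d_i^1)$ by $(d_i^1,x',d_{j-1}^1)$ or conversely (if the step directly before is a down-step), or it replaces $(d_i^0,x,d_j^1)$ by $(d_{j-1}^1,x',d_i^0)$ or $(d_j^0,x,d_i^1)$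 by $(d_i^1,x',d_{j-1}^0)$ (if the step directly before is an up-step). This stops when the step directly before it, at position $k$, is an up-step with the same index; put $\mathrm{start}(p)=k$. $\mathsf{ST}(\alpha)$ is the sequence whose $j$-th entry is $a^+$ if $\varphi_j$ is an up-step starting an event labelled $a$ (the label of the $i_j$-th event of $U_j$), and $a^{\mathrm{start}(j)}$ if $\varphi_j$ is a down-step ending an event labelled $a$ (the label of the $i_j$-th event of $U_{j-1}$). $I$-bisimulations. For $I\subseteq\{\sqsubseteq,\sqsupseteq,\leftrightarrows,\hookleftarrow\}$, an $I$-bisimulation between HDAs $\mathcal Y,\mathcal Z$ is a relation $\mathfrak R$ between paths of $\mathcal Y$ and of $\mathcal Z$ satisfying the following clauses, each also with the roles of $\mathcal Y$ and $\mathcal Z$ exchanged: (1) the length-$0$ paths of $\mathcal Y$ and $\mathcal Z$ are related; (2) if $(\alpha,\beta)\in\mathfrak R$ then $\mathsf{ST}(\alpha)=\mathsf{ST}(\beta)$; (3) if $(\alpha,\beta)\in\mathfrak R$ and $\alpha\hookrightarrow\alpha'$, there is $\beta'$ with $\beta\hookrightarrow\beta'$ and $(\alpha',\beta')\in\mathfrak R$; and those of the following whose symbol lies in $I$: ($\sqsubseteq$) if $(\alpha,\beta)\in\mathfrak R$ and $\alpha\sqsubseteq^\ell\alpha'$, there is $\beta'$ with $\beta\sqsubseteq^\ell\beta'$, $(\alpha',\beta')\in\mathfrak R$; ($\sqsupseteq$) the same with $\alpha'\sqsubseteq^\ell\alpha$ and $\beta'\sqsubseteq^\ell\beta$; ($\leftrightarrows$)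 the same with $\alpha'\leftrightarrows^\ell\alpha$ and $\beta'\leftrightarrows^\ell\beta$; ($\hookleftarrow$) the same with $\alpha'\hookrightarrow\alpha$ and $\beta'\hookrightarrow\beta$. $\mathcal Y,\mathcal Z$ are $I$-bisimilar, $\mathcal Y\,\underline{\leftrightarrow}_I\,\mathcal Z$, if an $I$-bisimulation between them exists. Names: hqhp is $I=\{\sqsubseteq,\leftrightarrows,\hookleftarrow\}$; hhp is $I=\{\sqsubseteq,\sqsupseteq,\leftrightarrows,\hookleftarrow\}$. -}

module Defs where

open import Data.Fin using (Fin; zero; suc; toℕ; cast; punchIn; punchOut; _≤_; _≟_)
open import Data.Fin.Properties
  using (any?; punchIn-injective; punchInᵢ≢i; punchIn-mono-≤; punchIn-punchOut; punchOut-punchIn)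
open import Data.List using (List; []; _∷ʳ_)
open import Data.Nat using (ℕ; zero; suc; _<_; s≤s; z≤n)
open import Data.Product using (∃; _×_; _,_; proj₂)
open import Data.Vec using (Vec; []; lookup; removeAt)
open import Data.Vec.Properties using (removeAt-punchOut)
open import Function using (_∘_; id; flip; _⇔_; mk⇔; Equivalence)
open import Function.Definitions using (Injective)
open import Level using (0ℓ)
open import Relation.Binary.Core using (Rel; REL; _Preserves_⟶_)
open import Relation.Binary.Construct.Closure.Symmetric using (SymClosure; fwd; bwd)
open import Relation.Binary.PropositionalEquality
  using (_≡_; _≢_; refl; sym; trans; cong)
open import Relation.Nullary using (¬_; yes; no; contradiction)
open import Relation.Unary using (Pred; _∈_; ｛_｝; _∪_)

private variable
  A : Set
  l m n : ℕ

-- A conclist (n , λ) over A is a vector of type Vec A n.  Positions in a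
-- conclist, hence the indices of coface maps, are counted from 0.

data Endpoint : Set where
  𝟎 𝟏 : Endpoint

data Mark : Set where
  ∗   : Mark
  end : Endpoint → Mark

infix 4 _⟶_ _≈_

record _⟶_ {A : Set} {m n : ℕ} (U : Vec A m) (V : Vec A n) : Set where
  field
    f           : Fin m → Fin n
    ε           : Fin n → Mark
    f-injective : Injective _≡_ _≡_ f
    f-monotone  : f Preserves _≤_ ⟶ _≤_
    f-label     : ∀ t → lookup V (f t) ≡ lookup U t
    ε-image     : ∀ u → ε u ≡ ∗ ⇔ ∃ λ t → f t ≡ u

open _⟶_ public

_≈_ : {U : Vec A m} {V : Vec A n} → Rel (U ⟶ V) 0ℓ
φ ≈ ψ = (∀ t → f φ t ≡ f ψ t) × (∀ u → ε φ u ≡ ε ψ u)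

idᵐ : (U : Vec A n) → U ⟶ U
idᵐ U = record
  { f           = id
  ; ε           = λ _ → ∗
  ; f-injective = id
  ; f-monotone  = id
  ; f-label     = λ _ → refl
  ; ε-image     = λ u → mk⇔ (λ _ → u , refl) (λ _ → refl)
  }

composeMarks : (Fin m → Fin n) → (Fin n → Mark) → (Fin m → Mark) → Fin n → Mark
composeMarks g ζ ε u with any? (λ t → g t ≟ u)
... | yes (t , _) = ε t
... | no  _       = ζ u

composeMarks-image : (g : Fin m → Fin n) (ζ : Fin n → Mark) (ε : Fin m → Mark) →
  Injective _≡_ _≡_ g → ∀ t → composeMarks g ζ ε (g t) ≡ ε t
composeMarks-image g ζ ε inj t with any? (λ s → g s ≟ g t)
... | yes (s , gs≡gt) = cong ε (inj gs≡gt)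
... | no  ∄s          = contradiction (t , refl) ∄s

composeMarks-outside : (g : Fin m → Fin n) (ζ : Fin n → Mark) (ε : Fin m → Mark) →
  ∀ u → ¬ (∃ λ t → g t ≡ u) → composeMarks g ζ ε u ≡ ζ u
composeMarks-outside g ζ ε u ∄t with any? (λ t → g t ≟ u)
... | yes t∈ = contradiction t∈ ∄t
... | no  _  = refl

infixr 9 _∘ᵐ_

_∘ᵐ_ : {U : Vec A l} {V : Vec A m} {W : Vec A n} → V ⟶ W → U ⟶ V → U ⟶ W
_∘ᵐ_ {n = n} ψ φ = record
  { f           = f ψ ∘ f φ
  ; ε           = η
  ; f-injective = f-injective φ ∘ f-injective ψ
  ; f-monotone  = f-monotone ψ ∘ f-monotone φ
  ; f-label     = λ t → trans (f-label ψ (f φ t)) (f-label φ t)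
  ; ε-image     = λ u → mk⇔ (to-image u) (from-image u)
  }
  where
  η : Fin n → Mark
  η = composeMarks (f ψ) (ε ψ) (ε φ)

  to-image : ∀ u → η u ≡ ∗ → ∃ λ t → f ψ (f φ t) ≡ u
  to-image u ηu≡∗ with any? (λ s → f ψ s ≟ u)
  ... | no ∄s = contradiction (Equivalence.to (ε-image ψ u) ηu≡∗) ∄s
  ... | yes (s , gs≡u) with Equivalence.to (ε-image φ s) ηu≡∗
  ...   | t , ft≡s = t , trans (cong (f ψ) ft≡s) gs≡u

  from-image : ∀ u → (∃ λ t → f ψ (f φ t) ≡ u) → η u ≡ ∗
  from-image _ (t , refl) =
    trans (composeMarks-image (f ψ) (ε ψ) (ε φ) (f-injective ψ) (f φ t))
          (Equivalence.from (ε-image φ (f φ t)) (t , refl))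

cofaceMarks : Endpoint → Fin n → Fin n → Mark
cofaceMarks k i j with i ≟ j
... | yes _ = end k
... | no  _ = ∗

coface : (k : Endpoint) (i : Fin (suc n)) (V : Vec A (suc n)) → removeAt V i ⟶ V
coface {n = n} k i V = record
  { f           = punchIn i
  ; ε           = cofaceMarks k i
  ; f-injective = punchIn-injective i _ _
  ; f-monotone  = punchIn-mono-≤ i _ _
  ; f-label     = label
  ; ε-image     = λ u → mk⇔ (to-image u) (from-image u)
  }
  where
  label : ∀ t → lookup V (punchIn i t) ≡ lookup (removeAt V i) t
  label t = trans (sym (removeAt-punchOut V (punchInᵢ≢i i t ∘ sym)))
                  (cong (lookup (removeAt V i)) (punchOut-punchIn i))

  to-image : ∀ u → cofaceMarks k i u ≡ ∗ → ∃ λ t → punchIn i t ≡ u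
  to-image u _ with i ≟ u
  to-image u () | yes _
  to-image u _  | no i≢u = punchOut i≢u , punchIn-punchOut i≢u

  from-image : ∀ u → (∃ λ t → punchIn i t ≡ u) → cofaceMarks k i u ≡ ∗
  from-image u (t , eq) with i ≟ u
  ... | yes i≡u = contradiction (trans eq (sym i≡u)) (punchInᵢ≢i i t)
  ... | no  _   = refl

-- Hom-sets of □ carry the pointwise equality _≈_, which a functor must respect.
record PrecubicalSet (A : Set) : Set₁ where
  field
    Cells    : Vec A n → Set
    act      : {U : Vec A m} {V : Vec A n} → U ⟶ V → Cells V → Cells U
    act-resp : {U : Vec A m} {V : Vec A n} {φ ψ : U ⟶ V} →
               φ ≈ ψ → ∀ x → act φ x ≡ act ψ x
    act-id   : {U : Vec A n} → ∀ x → act (idᵐ U) x ≡ x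
    act-∘    : {U : Vec A l} {V : Vec A m} {W : Vec A n} (ψ : V ⟶ W) (φ : U ⟶ V) →
               ∀ x → act (ψ ∘ᵐ φ) x ≡ act φ (act ψ x)

  δ : {V : Vec A (suc n)} (k : Endpoint) (i : Fin (suc n)) →
      Cells V → Cells (removeAt V i)
  δ k i = act (coface k i _)

record HDA (A : Set) : Set₁ where
  field
    precubicalSet : PrecubicalSet A
  open PrecubicalSet precubicalSet public
  field
    initial : Cells []

record Cell (X : HDA A) : Set where
  constructor ⟨_⟩
  field
    {dim}    : ℕ
    {events} : Vec A dim
    cell     : HDA.Cells X events

open Cell using (dim)

module _ {A : Set} (X : HDA A) where
  open HDA X

  data Step : Rel (Cell X) 0ℓ where
    up   : ∀ {c} {V : Vec A (suc n)} (i : Fin (suc n)) (y : Cells V) →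
           c ≡ ⟨ δ 𝟎 i y ⟩ → Step c ⟨ y ⟩
    down : ∀ {c} {V : Vec A (suc n)} (i : Fin (suc n)) (x : Cells V) →
           c ≡ ⟨ δ 𝟏 i x ⟩ → Step ⟨ x ⟩ c

  infixl 5 _▸_

  data PathTo : Cell X → Set where
    root : PathTo ⟨ initial ⟩
    _▸_  : ∀ {c c′} → PathTo c → Step c c′ → PathTo c′

  Path : Set
  Path = ∃ PathTo

module _ {X : HDA A} where

  empty : Path X
  empty = _ , root

  length : ∀ {c} → PathTo X c → ℕ
  length root    = zero
  length (α ▸ _) = suc (length α)

  infix 4 _↪_

  data _↪_ : Rel (Path X) 0ℓ where
    stop : ∀ {α} → α ↪ α
    more : ∀ {α c c′} {β : PathTo X c} {s : Step X c c′} →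
           α ↪ (c , β) → α ↪ (c′ , β ▸ s)

-- The coface map dᵏᵢ labelling a step, with its index as a number so that
-- indices into conclists of different dimensions can be compared.
data Label : Set where
  dˡ : Endpoint → ℕ → Label

stepLabel : {X : HDA A} {c c′ : Cell X} → Step X c c′ → Label
stepLabel (up i _ _)   = dˡ 𝟎 (toℕ i)
stepLabel (down i _ _) = dˡ 𝟏 (toℕ i)

infix 4 _⇝_ _⊏_

-- In all rules below, suc j stands for the larger of the two indices i < suc j,
-- so j is that index decremented.
data _⇝_ : Rel (Label × Label) 0ℓ where
  up-up     : ∀ {i j} → i < suc j →
              (dˡ 𝟎 i , dˡ 𝟎 (suc j)) ⇝ (dˡ 𝟎 j , dˡ 𝟎 i)
  down-down : ∀ {i j} → i < suc j →
              (dˡ 𝟏 (suc j) , dˡ 𝟏 i) ⇝ (dˡ 𝟏 i , dˡ 𝟏 j)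

data _⊏_ : Rel (Label × Label) 0ℓ where
  end-larger  : ∀ {i j} → i < suc j →
                (dˡ 𝟏 j , dˡ 𝟎 i) ⊏ (dˡ 𝟎 i , dˡ 𝟏 (suc j))
  end-smaller : ∀ {i j} → i < suc j →
                (dˡ 𝟏 i , dˡ 𝟎 j) ⊏ (dˡ 𝟎 (suc j) , dˡ 𝟏 i)

module _ {X : HDA A} where

  -- Replace P ℓ α β: the paths α and β coincide except for the cell at position
  -- ℓ ≥ 1 and the steps entering and leaving it, whose labels are related by P.
  data Replace (P : Rel (Label × Label) 0ℓ) : ℕ → Rel (Path X) 0ℓ where
    here  : ∀ {b c c′ e} {ρ : PathTo X b}
            {s : Step X b c} {t : Step X c e} {s′ : Step X b c′} {t′ : Step X c′ e} →
            P (stepLabel s , stepLabel t) (stepLabel s′ , stepLabel t′) →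
            Replace P (suc (length ρ)) (e , ρ ▸ s ▸ t) (e , ρ ▸ s′ ▸ t′)
    there : ∀ {ℓ c e} {α β : PathTo X c} {u : Step X c e} →
            Replace P ℓ (c , α) (c , β) → Replace P ℓ (e , α ▸ u) (e , β ▸ u)

  infix 4 _⊑[_]_ _⇆[_]_

  _⊑[_]_ : Path X → ℕ → Path X → Set
  α ⊑[ ℓ ] β = Replace _⊏_ ℓ α β

  _⇆[_]_ : Path X → ℕ → Path X → Set
  α ⇆[ ℓ ] β = SymClosure (Replace _⇝_ ℓ) α β

data Entry (A : Set) : Set where
  _⁺  : A → Entry A
  _^_ : A → ℕ → Entry A

module _ {X : HDA A} where

  -- startOf ρ i is start(p) for the down-step with index i directly after ρ.
  -- Moving it left over the last step of ρ changes its index as in _⇝_ and _⊏_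
  -- (see move-over-down and move-over-up below) and leaves the steps before
  -- untouched.  Steps of a path are numbered from 1.
  startOf : ∀ {c} → PathTo X c → Fin (dim c) → ℕ
  startOf root ()
  startOf (ρ ▸ down j _ eq) i = startOf ρ (punchIn j (cast (cong dim eq) i))
  startOf (ρ ▸ up j _ eq)   i with j ≟ i
  ... | yes _  = suc (length ρ)
  ... | no j≢i = startOf ρ (cast (cong dim (sym eq)) (punchOut j≢i))

  ST : ∀ {c} → PathTo X c → List (Entry A)
  ST root                     = []
  ST (ρ ▸ up {V = V} i _ _)   = ST ρ ∷ʳ (lookup V i ⁺)
  ST (ρ ▸ down {V = V} i _ _) = ST ρ ∷ʳ (lookup V i ^ startOf ρ i)

suc-⇝ : ∀ {i j k l} → (dˡ 𝟏 i , dˡ 𝟏 j) ⇝ (dˡ 𝟏 k , dˡ 𝟏 l) →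
        (dˡ 𝟏 (suc i) , dˡ 𝟏 (suc j)) ⇝ (dˡ 𝟏 (suc k) , dˡ 𝟏 (suc l))
suc-⇝ (down-down i<j) = down-down (s≤s i<j)

suc-⊏ : ∀ {i j k l} → (dˡ 𝟏 i , dˡ 𝟎 j) ⊏ (dˡ 𝟎 k , dˡ 𝟏 l) →
        (dˡ 𝟏 (suc i) , dˡ 𝟎 (suc j)) ⊏ (dˡ 𝟎 (suc k) , dˡ 𝟏 (suc l))
suc-⊏ (end-larger i<j)  = end-larger (s≤s i<j)
suc-⊏ (end-smaller i<j) = end-smaller (s≤s i<j)

move-over-down : (j : Fin (suc n)) (i : Fin n) → ∃ λ j′ →
  SymClosure _⇝_ (dˡ 𝟏 (toℕ j) , dˡ 𝟏 (toℕ i)) (dˡ 𝟏 (toℕ (punchIn j i)) , dˡ 𝟏 j′)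
move-over-down zero    i       = _ , bwd (down-down (s≤s z≤n))
move-over-down (suc j) zero    = _ , fwd (down-down (s≤s z≤n))
move-over-down (suc j) (suc i) with move-over-down j i
... | _ , fwd r = _ , fwd (suc-⇝ r)
... | _ , bwd r = _ , bwd (suc-⇝ r)

move-over-up : {j i : Fin (suc n)} (j≢i : j ≢ i) → ∃ λ j′ →
  (dˡ 𝟏 (toℕ (punchOut j≢i)) , dˡ 𝟎 j′) ⊏ (dˡ 𝟎 (toℕ j) , dˡ 𝟏 (toℕ i))
move-over-up             {j = zero}  {zero}  0≢0 = contradiction refl 0≢0
move-over-up             {j = zero}  {suc i} _   = _ , end-larger (s≤s z≤n)
move-over-up {n = suc _} {j = suc j} {zero}  _   = _ , end-smaller (s≤s z≤n)
move-over-up {n = suc _} {j = suc j} {suc i} j≢i with move-over-up (j≢i ∘ cong suc)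
... | _ , r = _ , suc-⊏ r

data Clause : Set where
  ⊑ ⊒ ⇆ ↩ : Clause

Transfers : {P Q : Set} → REL P Q 0ℓ → Rel P 0ℓ → Rel Q 0ℓ → Set
Transfers R _↝_ _↝′_ =
  ∀ {α β α′} → R α β → α ↝ α′ → ∃ λ β′ → β ↝′ β′ × R α′ β′

record IsSimulation (I : Pred Clause 0ℓ) (Y Z : HDA A)
                    (R : REL (Path Y) (Path Z) 0ℓ) : Set where
  field
    related-empty : R empty empty
    ST-equal      : ∀ {α β} → R α β → ST (proj₂ α) ≡ ST (proj₂ β)
    extension     : Transfers R _↪_ _↪_
    ⊑-clause      : ⊑ ∈ I → ∀ ℓ → Transfers R (λ α α′ → α ⊑[ ℓ ] α′) (λ β β′ → β ⊑[ ℓ ] β′)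
    ⊒-clause      : ⊒ ∈ I → ∀ ℓ → Transfers R (λ α α′ → α′ ⊑[ ℓ ] α) (λ β β′ → β′ ⊑[ ℓ ] β)
    ⇆-clause      : ⇆ ∈ I → ∀ ℓ → Transfers R (λ α α′ → α′ ⇆[ ℓ ] α) (λ β β′ → β′ ⇆[ ℓ ] β)
    ↩-clause      : ↩ ∈ I → Transfers R (λ α α′ → α′ ↪ α) (λ β β′ → β′ ↪ β)

record IsBisimulation (I : Pred Clause 0ℓ) (Y Z : HDA A)
                      (R : REL (Path Y) (Path Z) 0ℓ) : Set where
  field
    forth : IsSimulation I Y Z R
    back  : IsSimulation I Z Y (flip R)

Bisimilar : Pred Clause 0ℓ → HDA A → HDA A → Set₁
Bisimilar I Y Z = ∃ λ R → IsBisimulation I Y Z R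

hqhp hhp : Pred Clause 0ℓ
hqhp = ｛ ⊑ ｝ ∪ ｛ ⇆ ｝ ∪ ｛ ↩ ｝
hhp  = ｛ ⊑ ｝ ∪ ｛ ⊒ ｝ ∪ ｛ ⇆ ｝ ∪ ｛ ↩ ｝

module Submission where

-- 𝒴 and 𝒵 consist of three squares q₁, q₂, q₃ with concurrent events a and b.
-- The edge in which b runs before a is common to all squares; the edge in which a
-- runs before b is common to q₁ and q₂ only, and only after the other one, that
-- of q₃, can a c occur; the edge in which a runs after b is common to q₂ and q₃
-- only.  The edges of q₁ and q₂ in which b runs after a coincide in 𝒴 and differ
-- in 𝒵.
--
-- The clause for ⊑ asks which squares can replace a serialised part of a path.
-- The serialisations in 𝒴 and in 𝒵 have the same kinds of fillings, so 𝒴 and 𝒵 are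
-- hqhp-bisimilar.  With the clause for ⊒ one can also walk from square to square
-- through common serialisations: in 𝒴 this connects q₁ to q₃, but in 𝒵 it never
-- leaves q₁.

open import Defs
open import Data.Fin using (Fin; zero; suc; toℕ; punchOut; _≤_; _≟_)
open import Data.Fin.Properties
  using (any?; suc-injective; 0≢1+n; punchOut-injective; punchIn-punchOut; toℕ-injective)
open import Data.List using (List; []; _∷_; _∷ʳ_)
open import Data.List.Properties using (++-conicalʳ; ∷ʳ-injectiveˡ; ∷ʳ-injectiveʳ)
open import Data.List.Relation.Unary.All using ([]; _∷_)
open import Data.List.Relation.Unary.AllPairs using ([]; _∷_)
open import Data.List.Relation.Unary.Unique.Propositional using (Unique)
open import Data.Nat using (ℕ; zero; suc; _<_; z≤n; s≤s; s≤s⁻¹)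
open import Data.Product using (∃; _×_; _,_; proj₁; proj₂; ∃-syntax)
open import Data.Sum using (inj₁; inj₂)
open import Data.Unit using (⊤; tt)
open import Data.Vec using (Vec; []; _∷_; lookup; removeAt)
open import Function using (_∘_; case_of_; flip; id; _⇔_; mk⇔; Equivalence)
open import Function.Definitions using (Injective)
open import Level using (0ℓ)
open import Relation.Binary.Core using (Rel; REL; _Preserves_⟶_)
open import Relation.Binary.Construct.Closure.ReflexiveTransitive
  using (Star; _◅_; _◅◅_) renaming (ε to done)
open import Relation.Binary.Construct.Closure.Symmetric using (fwd; bwd; symmetric)
open import Relation.Binary.PropositionalEquality
  using (_≡_; _≢_; refl; sym; trans; cong; cong₂; subst; subst₂)
open import Relation.Nullary using (¬_; yes; no; contradiction)
open import Relation.Unary using (Pred; _⊆_)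

private variable
  A : Set
  l m n : ℕ
  x : A
  U V W : Vec A n

-- Morphisms of `□` as inductive faces.

-- A morphism of □ is determined by its marks; read as a Face, it can be acted
-- with by structural recursion.
data Face {A : Set} : Vec A m → Vec A n → Set where
  []   : Face [] []
  keep : {U : Vec A m} {V : Vec A n} → Face U V → Face (x ∷ U) (x ∷ V)
  fix  : {U : Vec A m} {V : Vec A n} → Endpoint → Face U V → Face U (x ∷ V)

position : {U : Vec A m} {V : Vec A n} → Face U V → Fin m → Fin n
position (keep w)  zero    = zero
position (keep w)  (suc t) = suc (position w t)
position (fix _ w) t       = suc (position w t)

marks : {V : Vec A n} → Face U V → Fin n → Mark
marks (keep w)  zero    = ∗
marks (keep w)  (suc u) = marks w u
marks (fix k w) zero    = end k
marks (fix k w) (suc u) = marks w u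

-- A mark tells `keep` from `fix` and carries the endpoint of the latter. Respect for `_≈_` and both
-- functor laws of `toPrecubicalSet` reduce in this way to comparing marks.
marks-injective : (w w′ : Face U V) → (∀ u → marks w u ≡ marks w′ u) → w ≡ w′
marks-injective []        []          eq = refl
marks-injective (keep w)  (keep w′)   eq = cong keep (marks-injective w w′ (eq ∘ suc))
marks-injective (keep w)  (fix k w′)  eq with () ← eq zero
marks-injective (fix k w) (keep w′)   eq with () ← eq zero
marks-injective (fix k w) (fix k′ w′) eq with refl ← eq zero =
  cong (fix k) (marks-injective w w′ (eq ∘ suc))

idᶠ : (U : Vec A n) → Face U U
idᶠ []      = []
idᶠ (_ ∷ U) = keep (idᶠ U)

marks-idᶠ : (U : Vec A n) → ∀ u → marks (idᶠ U) u ≡ ∗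
marks-idᶠ (_ ∷ U) zero    = refl
marks-idᶠ (_ ∷ U) (suc u) = marks-idᶠ U u

infixr 9 _∘ᶠ_

_∘ᶠ_ : Face V W → Face U V → Face U W
[]      ∘ᶠ w′       = w′
keep w  ∘ᶠ keep w′  = keep (w ∘ᶠ w′)
keep w  ∘ᶠ fix k w′ = fix k (w ∘ᶠ w′)
fix k w ∘ᶠ w′       = fix k (w ∘ᶠ w′)

marks-∘ᶠ-position : (w : Face V W) (w′ : Face U V) →
  ∀ t → marks (w ∘ᶠ w′) (position w t) ≡ marks w′ t
marks-∘ᶠ-position (keep w)  (keep w′)  zero    = refl
marks-∘ᶠ-position (keep w)  (keep w′)  (suc t) = marks-∘ᶠ-position w w′ t
marks-∘ᶠ-position (keep w)  (fix k w′) zero    = refl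
marks-∘ᶠ-position (keep w)  (fix k w′) (suc t) = marks-∘ᶠ-position w w′ t
marks-∘ᶠ-position (fix _ w) w′         t       = marks-∘ᶠ-position w w′ t

marks-∘ᶠ-end : (w : Face V W) (w′ : Face U V) →
  ∀ u → marks w u ≢ ∗ → marks (w ∘ᶠ w′) u ≡ marks w u
marks-∘ᶠ-end (keep w)  w′         zero    ≢∗ = contradiction refl ≢∗
marks-∘ᶠ-end (keep w)  (keep w′)  (suc u) ≢∗ = marks-∘ᶠ-end w w′ u ≢∗
marks-∘ᶠ-end (keep w)  (fix k w′) (suc u) ≢∗ = marks-∘ᶠ-end w w′ u ≢∗
marks-∘ᶠ-end (fix k w) w′         zero    ≢∗ = refl
marks-∘ᶠ-end (fix k w) w′         (suc u) ≢∗ = marks-∘ᶠ-end w w′ u ≢∗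

record Represents {A : Set} {U : Vec A m} {V : Vec A n} (w : Face U V) (φ : U ⟶ V) : Set where
  constructor _,_
  field
    position-≡ : ∀ t → position w t ≡ f φ t
    marks-≡    : ∀ u → marks w u ≡ ε φ u

open Represents

-- For the recursion of `toFace`, which needs a morphism into the tail of the conclist. As `h`
-- avoids `zero`, `punchOut` takes predecessors; `h` is `f φ` when the first position is fixed and
-- `f φ ∘ suc` when it is kept.
lower : {U : Vec A m} {V : Vec A n} {y : A} (h : Fin m → Fin (suc n)) (ζ : Fin n → Mark) →
        (∀ t → zero ≢ h t) → Injective _≡_ _≡_ h → h Preserves _≤_ ⟶ _≤_ →
        (∀ t → lookup (y ∷ V) (h t) ≡ lookup U t) →
        (∀ u → ζ u ≡ ∗ ⇔ ∃ λ t → h t ≡ suc u) → U ⟶ V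
lower {y = y} h ζ 0≢h inj mono label image = record
  { f           = λ t → punchOut (0≢h t)
  ; ε           = ζ
  ; f-injective = λ eq → inj (punchOut-injective (0≢h _) (0≢h _) eq)
  ; f-monotone  = λ s≤t → s≤s⁻¹ (subst₂ _≤_ (suc-pred _) (suc-pred _) (mono s≤t))
  ; f-label     = λ t → trans (cong (lookup (y ∷ _)) (sym (suc-pred t))) (label t)
  ; ε-image     = λ u → mk⇔
      (λ eq → let t , ht≡ = Equivalence.to (image u) eq in
              t , suc-injective (trans (sym (suc-pred t)) ht≡))
      (λ (t , eq) → Equivalence.from (image u) (t , trans (suc-pred t) (cong suc eq)))
  }
  where
  suc-pred : ∀ t → h t ≡ suc (punchOut (0≢h t))
  suc-pred t = sym (punchIn-punchOut (0≢h t))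

toFace : (φ : U ⟶ V) → ∃ λ w → Represents w φ
toFace {U = []}    {V = []} φ = [] , ((λ ()) , λ ())
toFace {U = _ ∷ _} {V = []} φ with () ← f φ zero
toFace {U = U} {V = y ∷ V} φ with ε φ zero in εφ0
... | end k =
  let w , r = toFace (lower (f φ) (ε φ ∘ suc) 0≢f (f-injective φ) (f-monotone φ) (f-label φ)
                            (ε-image φ ∘ suc)) in
  fix k w , ( (λ t → trans (cong suc (position-≡ r t)) (punchIn-punchOut (0≢f t)))
            , λ { zero → sym εφ0 ; (suc u) → marks-≡ r u })
  where
  0≢f : ∀ t → zero ≢ f φ t
  0≢f t 0≡ft with () ← trans (sym εφ0) (Equivalence.from (ε-image φ zero) (t , sym 0≡ft))
toFace {U = []} {V = _ ∷ _} φ | ∗ with () ← Equivalence.to (ε-image φ zero) εφ0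
toFace {U = x ∷ U} {V = y ∷ V} φ | ∗ with f φ zero in fφ0 | f-label φ zero
... | zero | refl =
  let w , r = toFace (lower (f φ ∘ suc) (ε φ ∘ suc) 0≢f (suc-injective ∘ f-injective φ)
                            (f-monotone φ ∘ s≤s) (f-label φ ∘ suc) image) in
  keep w , ( (λ { zero → sym fφ0
                ; (suc t) → trans (cong suc (position-≡ r t)) (punchIn-punchOut (0≢f t)) })
           , λ { zero → sym εφ0 ; (suc u) → marks-≡ r u })
  where
  0≢f : ∀ t → zero ≢ f φ (suc t)
  0≢f t 0≡ft = 0≢1+n (f-injective φ (trans fφ0 0≡ft))

  image : ∀ u → ε φ (suc u) ≡ ∗ ⇔ ∃ λ t → f φ (suc t) ≡ suc u
  image u = mk⇔
    (λ eq → case Equivalence.to (ε-image φ (suc u)) eq of λ where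
      (zero , f0≡) → contradiction (trans (sym fφ0) f0≡) 0≢1+n
      (suc t , ft≡) → t , ft≡)
    (λ (t , eq) → Equivalence.from (ε-image φ (suc u)) (suc t , eq))
-- The mark `∗` yields some `t` sent to `zero`; since `zero ≤ t`, monotonicity puts the successor
-- `f φ zero` below `zero`.
... | suc _ | _ =
  let t , ft≡0 = Equivalence.to (ε-image φ zero) εφ0 in
  contradiction (subst₂ _≤_ fφ0 ft≡0 (f-monotone φ z≤n)) λ ()

face : U ⟶ V → Face U V
face φ = proj₁ (toFace φ)

marks-face : (φ : U ⟶ V) → ∀ u → marks (face φ) u ≡ ε φ u
marks-face φ = marks-≡ (proj₂ (toFace φ))

face-idᵐ : (U : Vec A n) → face (idᵐ U) ≡ idᶠ U
face-idᵐ U = marks-injective _ _ λ u → trans (marks-face (idᵐ U) u) (sym (marks-idᶠ U u))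

face-∘ᵐ : (ψ : V ⟶ W) (φ : U ⟶ V) → face (ψ ∘ᵐ φ) ≡ face ψ ∘ᶠ face φ
face-∘ᵐ ψ φ = marks-injective _ _ λ u → trans (marks-face (ψ ∘ᵐ φ) u) (pointwise u)
  where
  compose = composeMarks (f ψ) (ε ψ) (ε φ)

  pointwise : ∀ u → compose u ≡ marks (face ψ ∘ᶠ face φ) u
  pointwise u with any? (λ t → f ψ t ≟ u)
  ... | yes (t , refl) = trans (sym (marks-face φ t)) (trans
    (sym (marks-∘ᶠ-position (face ψ) (face φ) t))
    (cong (marks (face ψ ∘ᶠ face φ)) (position-≡ (proj₂ (toFace ψ)) t)))
  ... | no ∄t = trans (sym (marks-face ψ u))
    (sym (marks-∘ᶠ-end (face ψ) (face φ) u
      (∄t ∘ Equivalence.to (ε-image ψ u) ∘ trans (sym (marks-face ψ u)))))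

-- Presheaves on faces: here restriction is defined by pattern matching and the laws can hold by
-- computation, which the function-valued morphisms of `□` do not allow.
record FacePresheaf (A : Set) : Set₁ where
  field
    Cells       : Vec A n → Set
    restrict    : {U : Vec A m} {V : Vec A n} → Face U V → Cells V → Cells U
    restrict-id : {U : Vec A n} → ∀ x → restrict (idᶠ U) x ≡ x
    restrict-∘  : {U : Vec A l} {V : Vec A m} {W : Vec A n} (w : Face V W) (w′ : Face U V) →
                  ∀ x → restrict (w ∘ᶠ w′) x ≡ restrict w′ (restrict w x)

  toPrecubicalSet : PrecubicalSet A
  toPrecubicalSet = record
    { Cells    = Cells
    ; act      = λ φ → restrict (face φ)
    ; act-resp = λ {_} {_} {_} {_} {φ} {ψ} (_ , ε≗) x → cong (λ w → restrict w x)
        (marks-injective _ _ λ u → trans (marks-face φ u) (trans (ε≗ u) (sym (marks-face ψ u))))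
    ; act-id   = λ {_} {U} x → trans (cong (λ w → restrict w x) (face-idᵐ U)) (restrict-id x)
    ; act-∘    = λ ψ φ x →
        trans (cong (λ w → restrict w x) (face-∘ᵐ ψ φ)) (restrict-∘ (face ψ) (face φ) x)
    }

-- Inclusion of hhp-bisimilarity in hqhp-bisimilarity.

module _ {X Y : HDA A} {R : REL (Path X) (Path Y) 0ℓ} where

  IsSimulation-⊆ : {I J : Pred Clause 0ℓ} → I ⊆ J → IsSimulation J X Y R → IsSimulation I X Y R
  IsSimulation-⊆ I⊆J sim = record
    { related-empty = related-empty
    ; ST-equal      = ST-equal
    ; extension     = extension
    ; ⊑-clause      = ⊑-clause ∘ I⊆J
    ; ⊒-clause      = ⊒-clause ∘ I⊆J
    ; ⇆-clause      = ⇆-clause ∘ I⊆J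
    ; ↩-clause      = ↩-clause ∘ I⊆J
    }
    where open IsSimulation sim

  -- Serves the converse direction of a bisimulation: the simulation built from right to left has
  -- its own relation, which is only equivalent to the flipped one.
  IsSimulation-resp : {I : Pred Clause 0ℓ} {R′ : REL (Path X) (Path Y) 0ℓ} →
    (∀ {α β} → R α β → R′ α β) → (∀ {α β} → R′ α β → R α β) →
    IsSimulation I X Y R → IsSimulation I X Y R′
  IsSimulation-resp {R′ = R′} to from sim = record
    { related-empty = to related-empty
    ; ST-equal      = ST-equal ∘ from
    ; extension     = resp extension
    ; ⊑-clause      = λ i ℓ → resp (⊑-clause i ℓ)
    ; ⊒-clause      = λ i ℓ → resp (⊒-clause i ℓ)
    ; ⇆-clause      = λ i ℓ → resp (⇆-clause i ℓ)
    ; ↩-clause      = λ i → resp (↩-clause i)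
    }
    where
    open IsSimulation sim
    resp : {_↝_ : Rel (Path X) 0ℓ} {_↝′_ : Rel (Path Y) 0ℓ} →
           Transfers R _↝_ _↝′_ → Transfers R′ _↝_ _↝′_
    resp transfer r step = let β′ , step′ , r′ = transfer (from r) step in β′ , step′ , to r′

hqhp⊆hhp : hqhp ⊆ hhp
hqhp⊆hhp (inj₁ refl)        = inj₁ refl
hqhp⊆hhp (inj₂ (inj₁ refl)) = inj₂ (inj₂ (inj₁ refl))
hqhp⊆hhp (inj₂ (inj₂ refl)) = inj₂ (inj₂ (inj₂ refl))

hhp⇒hqhp : {Y Z : HDA A} → Bisimilar hhp Y Z → Bisimilar hqhp Y Z
hhp⇒hqhp (R , bisim) = R , record
  { forth = IsSimulation-⊆ hqhp⊆hhp forth ; back = IsSimulation-⊆ hqhp⊆hhp back }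
  where open IsBisimulation bisim

-- Sequences of moves under an hhp-simulation.

-- Extension is left out on purpose: confinement to a square survives all of these moves, but not an
-- arbitrary extension.
data Move {X : HDA A} : Rel (Path X) 0ℓ where
  retract     : ∀ {α α′} → α′ ↪ α → Move α α′
  parallelise : ∀ {α α′ ℓ} → α ⊑[ ℓ ] α′ → Move α α′
  serialise   : ∀ {α α′ ℓ} → α′ ⊑[ ℓ ] α → Move α α′
  swap        : ∀ {α α′ ℓ} → α′ ⇆[ ℓ ] α → Move α α′

module _ {Y Z : HDA A} {R : REL (Path Y) (Path Z) 0ℓ} (sim : IsSimulation hhp Y Z R) where
  open IsSimulation sim

  Move-transfers : Transfers R Move Move
  Move-transfers r (retract e) =
    let _ , e′ , r′ = ↩-clause (inj₂ (inj₂ (inj₂ refl))) r e in _ , retract e′ , r′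
  Move-transfers r (parallelise {ℓ = ℓ} e) =
    let _ , e′ , r′ = ⊑-clause (inj₁ refl) ℓ r e in _ , parallelise e′ , r′
  Move-transfers r (serialise {ℓ = ℓ} e) =
    let _ , e′ , r′ = ⊒-clause (inj₂ (inj₁ refl)) ℓ r e in _ , serialise e′ , r′
  Move-transfers r (swap {ℓ = ℓ} e) =
    let _ , e′ , r′ = ⇆-clause (inj₂ (inj₂ (inj₁ refl))) ℓ r e in _ , swap e′ , r′

  Moves-transfers : Transfers R (Star Move) (Star Move)
  Moves-transfers r done     = _ , done , r
  Moves-transfers r (e ◅ es) =
    let _ , e′ , r′ = Move-transfers r e ; _ , es′ , r″ = Moves-transfers r′ es in
    _ , e′ ◅ es′ , r″

-- Simulations of paths from local relations between cells.

-- Stated for arbitrary numbers, where `up-up` can be matched; on the `toℕ` of positions unification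
-- gets stuck.
⇝-up-inversion : ∀ {i j k l} → (dˡ 𝟎 i , dˡ 𝟎 j) ⇝ (dˡ 𝟎 k , dˡ 𝟎 l) →
                 i ≡ l × j ≡ suc k × i < j
⇝-up-inversion (up-up i<j) = refl , refl , i<j

⇝-down-inversion : ∀ {i j k l} → (dˡ 𝟏 j , dˡ 𝟏 i) ⇝ (dˡ 𝟏 l , dˡ 𝟏 k) →
                   i ≡ l × j ≡ suc k × i < j
⇝-down-inversion (down-down i<j) = refl , refl , i<j

endpoint : Label → Endpoint
endpoint (dˡ k _) = k

Replace-flip : {X : HDA A} {P : Rel (Label × Label) 0ℓ} {α β : Path X} →
               Replace P l α β → Replace (flip P) l β α
Replace-flip (here p)  = here p
Replace-flip (there r) = there (Replace-flip r)

Replace-end : {X : HDA A} {P : Rel (Label × Label) 0ℓ} {α β : Path X} →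
              Replace P l α β → proj₁ α ≡ proj₁ β
Replace-end (here _)  = refl
Replace-end (there _) = refl

-- The precubical identities for equal endpoints. They equate elements of `Cell X` because the two
-- conclists arise by different removals, and compare indices by `toℕ` as `_⇝_` does.
Commuting : {A : Set} → HDA A → Set
Commuting {A} X = ∀ {n} {V : Vec A (suc (suc n))} (k : Endpoint) (x : Cells V)
  {i j : Fin (suc (suc n))} {i′ j′ : Fin (suc n)} →
  toℕ i′ ≡ toℕ i → toℕ j ≡ suc (toℕ j′) → toℕ i′ < toℕ j →
  _≡_ {A = Cell X} ⟨ δ k i′ (δ k j x) ⟩ ⟨ δ k j′ (δ k i x) ⟩
  where open HDA X

module _ {A : Set} (X Y : HDA A) where
  private
    module X = HDA X
    module Y = HDA Y

  CellRelation : Set₁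
  CellRelation = ∀ {n} {U : Vec A n} → X.Cells U → Y.Cells U → Set

  -- _~_ relates the cells where two paths may be, _≃_ those that they may enter
  -- by starting an event.
  record IsLocalSimulation (_~_ _≃_ : CellRelation) : Set where
    field
      ~-initial : X.initial ~ Y.initial
      ≃⇒~       : {U : Vec A n} {x : X.Cells U} {y : Y.Cells U} → x ≃ y → x ~ y
      ~-δ𝟏      : {V : Vec A (suc n)} {x : X.Cells V} {y : Y.Cells V} (i : Fin (suc n)) →
                  x ~ y → X.δ 𝟏 i x ~ Y.δ 𝟏 i y
      ≃-δ𝟎      : {V : Vec A (suc n)} {x : X.Cells V} {y : Y.Cells V} (i : Fin (suc n)) →
                  x ≃ y → X.δ 𝟎 i x ≃ Y.δ 𝟎 i y
      ~-lift    : {V : Vec A (suc n)} (i : Fin (suc n)) (x : X.Cells V)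
                  {y : Y.Cells (removeAt V i)} → X.δ 𝟎 i x ~ y →
                  ∃ λ y⁺ → x ≃ y⁺ × Y.δ 𝟎 i y⁺ ≡ y
      -- For the clause `⊑`: `y` is where the path was before event `j` ended, and `z` is the cell
      -- it entered by starting event `i`. Hence `_~_` for the former and `_≃_` for the latter.
      ~-fill    : {V : Vec A (suc (suc n))} (i j : Fin (suc (suc n))) (x : X.Cells V)
                  {y : Y.Cells (removeAt V i)} {z : Y.Cells (removeAt V j)} →
                  X.δ 𝟎 i x ~ y → X.δ 𝟏 j x ≃ z →
                  ∃ λ w → x ≃ w × Y.δ 𝟎 i w ≡ y × Y.δ 𝟏 j w ≡ z

  data Lift (_~_ : CellRelation) : Cell X → Cell Y → Set where
    ⟨_⟩ : {U : Vec A n} {x : X.Cells U} {y : Y.Cells U} → x ~ y → Lift _~_ ⟨ x ⟩ ⟨ y ⟩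

  -- Down-steps carry no condition on the cell they enter: it is a face of the cell before, so
  -- `final-~` recovers `_~_` there.
  data Related (_≃_ : CellRelation) : ∀ {c c′} → PathTo X c → PathTo Y c′ → Set where
    root : Related _≃_ root root
    up   : ∀ {c c′} {α : PathTo X c} {β : PathTo Y c′} {V : Vec A (suc n)} {i : Fin (suc n)}
           {x : X.Cells V} {y : Y.Cells V} {p q} →
           Related _≃_ α β → x ≃ y → Related _≃_ (α ▸ up i x p) (β ▸ up i y q)
    down : ∀ {V : Vec A (suc n)} {i : Fin (suc n)} {x : X.Cells V} {y : Y.Cells V}
           {α : PathTo X ⟨ x ⟩} {β : PathTo Y ⟨ y ⟩} {c c′} {p : c ≡ _} {q : c′ ≡ _} →
           Related _≃_ α β → Related _≃_ (α ▸ down i x p) (β ▸ down i y q)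

Related-sym : {X Y : HDA A} {_≃₁_ : CellRelation X Y} {_≃₂_ : CellRelation Y X} →
  (∀ {n} {U : Vec A n} {x : HDA.Cells X U} {y} → x ≃₁ y → y ≃₂ x) →
  ∀ {c c′} {α : PathTo X c} {β : PathTo Y c′} → Related X Y _≃₁_ α β → Related Y X _≃₂_ β α
Related-sym ≃-sym root       = root
Related-sym ≃-sym (up r x≃y) = up (Related-sym ≃-sym r) (≃-sym x≃y)
Related-sym ≃-sym (down r)   = down (Related-sym ≃-sym r)

module LocalSimulation {A : Set} {X Y : HDA A} {_~_ _≃_ : CellRelation X Y}
  (local : IsLocalSimulation X Y _~_ _≃_) (commuting : Commuting Y) where

  private
    module X = HDA X
    module Y = HDA Y
  open IsLocalSimulation local

  private
    _≈ₚ_ : ∀ {c c′} → PathTo X c → PathTo Y c′ → Set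
    _≈ₚ_ = Related X Y _≃_

    variable
      c : Cell X
      c′ : Cell Y
      α α′ : PathTo X c
      β : PathTo Y c′

  final-~ : {α : PathTo X c} {β : PathTo Y c′} → α ≈ₚ β → Lift X Y _~_ c c′
  final-~ root       = ⟨ ~-initial ⟩
  final-~ (up r x≃y) = ⟨ ≃⇒~ x≃y ⟩
  final-~ (down {i = i} {p = refl} {refl} r)
    with ⟨ x~y ⟩ ← final-~ r = ⟨ ~-δ𝟏 i x~y ⟩

  length-≡ : α ≈ₚ β → length α ≡ length β
  length-≡ root     = refl
  length-≡ (up r _) = cong suc (length-≡ r)
  length-≡ (down r) = cong suc (length-≡ r)

  -- Indices are compared by `toℕ` because the dimensions of `c` and `c′` coincide only once the
  -- last steps are matched.
  startOf-≡ : {α : PathTo X c} {β : PathTo Y c′} → α ≈ₚ β → ∀ {i j} → toℕ i ≡ toℕ j →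
              startOf α i ≡ startOf β j
  startOf-≡ root {()}
  startOf-≡ (up {i = i} {p = refl} {refl} r _) {j} eq
    with refl ← toℕ-injective eq
    with i ≟ j
  ... | yes _ = cong suc (length-≡ r)
  ... | no  _ = startOf-≡ r refl
  startOf-≡ (down {p = refl} {refl} r) eq
    with refl ← toℕ-injective eq = startOf-≡ r refl

  ST-≡ : α ≈ₚ β → ST α ≡ ST β
  ST-≡ root                 = refl
  ST-≡ (up {V = V} {i} r _) = cong (_∷ʳ (lookup V i ⁺)) (ST-≡ r)
  ST-≡ (down {V = V} {i} r) =
    cong₂ (λ σ k → σ ∷ʳ (lookup V i ^ k)) (ST-≡ r) (startOf-≡ r refl)

  extend-step : {α : PathTo X c} {β : PathTo Y c′} → α ≈ₚ β → ∀ {d} (s : Step X c d) →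
                ∃ λ d′ → ∃ λ (t : Step Y c′ d′) → (α ▸ s) ≈ₚ (β ▸ t)
  extend-step r (up i x refl)
    with ⟨ δx~y ⟩ ← final-~ r
    with y⁺ , x≃y⁺ , δy⁺≡y ← ~-lift i x δx~y =
    ⟨ y⁺ ⟩ , up i y⁺ (cong ⟨_⟩ (sym δy⁺≡y)) , up r x≃y⁺
  extend-step r (down i x refl) with ⟨_⟩ {y = y} _ ← final-~ r =
    _ , down i y refl , down r

  _≈ᴾ_ : Path X → Path Y → Set
  (_ , α) ≈ᴾ (_ , β) = α ≈ₚ β

  extension-transfers : Transfers _≈ᴾ_ _↪_ _↪_
  extension-transfers r stop = _ , stop , r
  extension-transfers r (more {s = s} e) =
    let _ , e′ , r′ = extension-transfers r e ; _ , t , r″ = extend-step r′ s in _ , more e′ , r″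

  retraction-transfers : Transfers _≈ᴾ_ (λ α α′ → α′ ↪ α) (λ β β′ → β′ ↪ β)
  retraction-transfers r        stop     = _ , stop , r
  retraction-transfers (up r _) (more e) =
    let _ , e′ , r′ = retraction-transfers r e in _ , more e′ , r′
  retraction-transfers (down r) (more e) =
    let _ , e′ , r′ = retraction-transfers r e in _ , more e′ , r′

  TransfersReplacement : Rel (Label × Label) 0ℓ → Set
  TransfersReplacement P =
    ∀ {b d d′ e} {ρ : PathTo X b} {s : Step X b d} {t : Step X d e}
      {s′ : Step X b d′} {t′ : Step X d′ e} {e′} {β : PathTo Y e′} →
    (ρ ▸ s ▸ t) ≈ₚ β → P (stepLabel s , stepLabel t) (stepLabel s′ , stepLabel t′) →
    ∃ λ β′ → Replace P (suc (length ρ)) (e′ , β) (e′ , β′) × (ρ ▸ s′ ▸ t′) ≈ₚ β′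

  replace : ∀ {P ℓ} → TransfersReplacement P → {β : PathTo Y c′} → α ≈ₚ β →
            Replace P ℓ (c , α) (c , α′) →
            ∃ λ β′ → Replace P ℓ (c′ , β) (c′ , β′) × α′ ≈ₚ β′
  replace transfer r          (here p)  = transfer r p
  replace transfer (up r x≃y) (there R) =
    let _ , R′ , r′ = replace transfer r R in _ , there R′ , up r′ x≃y
  replace transfer (down r)   (there R) =
    let _ , R′ , r′ = replace transfer r R in _ , there R′ , down r′

  here′ : ∀ {P} {b b′ d d′ e} {ρ : PathTo X b} {ρ′ : PathTo Y b′}
    {s : Step Y b′ d} {t : Step Y d e} {s′ : Step Y b′ d′} {t′ : Step Y d′ e} → ρ ≈ₚ ρ′ →
    P (stepLabel s , stepLabel t) (stepLabel s′ , stepLabel t′) →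
    Replace P (suc (length ρ)) (e , ρ′ ▸ s ▸ t) (e , ρ′ ▸ s′ ▸ t′)
  here′ {P = P} r p = subst (λ ℓ → Replace P (suc ℓ) _ _) (sym (length-≡ r)) (here p)

  -- An end followed by a start becomes a start followed by an end. The cell from `~-fill` has
  -- exactly the old neighbouring cells as faces, so the rest of the path in `Y` is kept.
  transfers-⊏ : TransfersReplacement _⊏_
  transfers-⊏ {s′ = up i w refl} {down j _ refl} (up (down r) z≃z′) P
    with ⟨ x~y ⟩ ← final-~ r
    with w′ , w≃w′ , refl , refl ← ~-fill i j w x~y z≃z′ =
    _ , here′ {s′ = up i w′ refl} {down j w′ refl} r P , down (up r w≃w′)

  -- What `_⇝_` and its converse have in common, so that both directions of `⇆` are treated at once.
  record IsExchange (P : Rel (Label × Label) 0ℓ) : Set where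
    field
      same-kind : ∀ {l₁ l₂ l₃ l₄} → P (l₁ , l₂) (l₃ , l₄) →
                  endpoint l₁ ≡ endpoint l₄ × endpoint l₂ ≡ endpoint l₄ ×
                  endpoint l₃ ≡ endpoint l₄
      δ𝟎-comm   : {V : Vec A (suc (suc n))} (y : Y.Cells V)
                  {i j : Fin (suc (suc n))} {i′ j′ : Fin (suc n)} →
                  P (dˡ 𝟎 (toℕ i′) , dˡ 𝟎 (toℕ j)) (dˡ 𝟎 (toℕ j′) , dˡ 𝟎 (toℕ i)) →
                  _≡_ {A = Cell Y} ⟨ Y.δ 𝟎 i′ (Y.δ 𝟎 j y) ⟩ ⟨ Y.δ 𝟎 j′ (Y.δ 𝟎 i y) ⟩
      δ𝟏-comm   : {V : Vec A (suc (suc n))} (y : Y.Cells V)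
                  {i j : Fin (suc (suc n))} {i′ j′ : Fin (suc n)} →
                  P (dˡ 𝟏 (toℕ j) , dˡ 𝟏 (toℕ i′)) (dˡ 𝟏 (toℕ i) , dˡ 𝟏 (toℕ j′)) →
                  _≡_ {A = Cell Y} ⟨ Y.δ 𝟏 i′ (Y.δ 𝟏 j y) ⟩ ⟨ Y.δ 𝟏 j′ (Y.δ 𝟏 i y) ⟩

  ⇝-exchange : IsExchange _⇝_
  ⇝-exchange = record
    { same-kind = λ { (up-up _) → refl , refl , refl ; (down-down _) → refl , refl , refl }
    ; δ𝟎-comm   = λ y P → let i≡ , j≡ , i<j = ⇝-up-inversion P in commuting 𝟎 y i≡ j≡ i<j
    ; δ𝟏-comm   = λ y P → let i≡ , j≡ , i<j = ⇝-down-inversion P in commuting 𝟏 y i≡ j≡ i<j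
    }

  ⇜-exchange : IsExchange (flip _⇝_)
  ⇜-exchange = record
    { same-kind = λ { (up-up _) → refl , refl , refl ; (down-down _) → refl , refl , refl }
    ; δ𝟎-comm   = λ y P →
        let j≡ , i≡ , j<i = ⇝-up-inversion P in sym (commuting 𝟎 y j≡ i≡ j<i)
    ; δ𝟏-comm   = λ y P →
        let j≡ , i≡ , j<i = ⇝-down-inversion P in sym (commuting 𝟏 y j≡ i≡ j<i)
    }

  -- Two starts are determined by their indices and the last cell, two ends by their indices and the
  -- first. The new middle cell is thus a face of a cell that stays, and `IsExchange` makes the
  -- outer cells match.
  transfers-exchange : ∀ {P} → IsExchange P → TransfersReplacement P
  transfers-exchange ex {s′ = up j′ _ refl} {up i _ refl}
    (up {y = w′} {p = refl} {refl} (up {q = q} r _) w≃w′) p =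
    _ , here′ {s′ = up j′ (Y.δ 𝟎 i w′) (trans q (δ𝟎-comm w′ p))} {up i w′ refl} r p
      , up (up r (≃-δ𝟎 i w≃w′)) w≃w′
    where open IsExchange ex
  transfers-exchange ex {s′ = down i _ refl} {down j′ _ q}
    (down {q = q′} (down {y = w′} {p = refl} {refl} r)) p =
    _ , here′ {s′ = down i w′ refl} {down j′ (Y.δ 𝟏 i w′) (trans q′ (δ𝟏-comm w′ p))} r p
      , down (down r)
    where open IsExchange ex
  transfers-exchange ex {s′ = up _ _ _} {down _ _ _} r p
    with _ , _ , () ← IsExchange.same-kind ex p
  transfers-exchange ex {s′ = down _ _ _} {up _ _ _} r p
    with _ , _ , () ← IsExchange.same-kind ex p
  transfers-exchange ex {s′ = up _ _ _} {up _ _ _} (down r) p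
    with _ , () , _ ← IsExchange.same-kind ex p
  transfers-exchange ex {s′ = down _ _ _} {down _ _ _} (up r _) p
    with _ , () , _ ← IsExchange.same-kind ex p
  transfers-exchange ex {s′ = up _ _ _} {up _ _ _} (up (down r) _) p
    with () , _ ← IsExchange.same-kind ex p
  transfers-exchange ex {s′ = down _ _ _} {down _ _ _} (down (up r _)) p
    with () , _ ← IsExchange.same-kind ex p

  Replace-transfers : ∀ {P} → TransfersReplacement P → ∀ ℓ →
                      Transfers _≈ᴾ_ (Replace P ℓ) (Replace P ℓ)
  Replace-transfers transfer ℓ r R with refl ← Replace-end R =
    let _ , R′ , r′ = replace transfer r R in _ , R′ , r′

  ⇆-transfers : ∀ ℓ → Transfers _≈ᴾ_ (λ α α′ → α′ ⇆[ ℓ ] α) (λ β β′ → β′ ⇆[ ℓ ] β)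
  ⇆-transfers ℓ r (fwd R) =
    let _ , R′ , r′ = Replace-transfers (transfers-exchange ⇜-exchange) ℓ r (Replace-flip R) in
    _ , fwd (Replace-flip R′) , r′
  ⇆-transfers ℓ r (bwd R) =
    let _ , R′ , r′ = Replace-transfers (transfers-exchange ⇝-exchange) ℓ r R in
    _ , bwd R′ , r′

  simulation : IsSimulation hqhp X Y _≈ᴾ_
  simulation = record
    { related-empty = root
    ; ST-equal      = ST-≡
    ; extension     = extension-transfers
    ; ⊑-clause      = λ _ → Replace-transfers transfers-⊏
    ; ⊒-clause      = λ { (inj₂ (inj₁ ())) ; (inj₂ (inj₂ ())) }
    ; ⇆-clause      = λ _ → ⇆-transfers
    ; ↩-clause      = λ _ → retraction-transfers
    }

-- A family of HDAs with three squares.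

--                  topE e
--      afterB ─────────────→ final          A square q has bottom edge s = bottom q,
--         ↑                    ↑            top edge e = top q and right edge
--   leftE │         q          │ rightE g   g = right q.  Event a runs to the right,
--         │                    │            event b upwards.  An edge exitE labelled
--      origin ──────────────→ afterA s      c leads from afterA s₂ to exited.
--                 bottomE s

data Bottom : Set where s₁ s₂ : Bottom
data Top    : Set where e₁ e₂ : Top
data Square : Set where q₁ q₂ q₃ : Square

bottom : Square → Bottom
bottom q₁ = s₁
bottom q₂ = s₁
bottom q₃ = s₂

top : Square → Top
top q₁ = e₁
top q₂ = e₂
top q₃ = e₂

-- foot g is the bottom edge after which the right edge g starts.
record RightEdges : Set₁ where
  field
    Right        : Set
    right        : Square → Right
    foot         : Right → Bottom
    foot-right   : ∀ q → foot (right q) ≡ bottom q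
    -- Every right edge bounds a square; through that square, right edges of different members of
    -- the family are compared.
    filler       : Right → Square
    right-filler : ∀ g → right (filler g) ≡ g

data Vertex : Set where
  origin afterB final exited : Vertex
  afterA                     : Bottom → Vertex

module Example {A : Set} (a b c : A) where

  data Edge (T : Set) : Set where
    bottomE : Bottom → Edge T
    topE    : Top → Edge T
    leftE   : Edge T
    rightE  : T → Edge T
    exitE   : Edge T

  label : ∀ {T} → Edge T → A
  label (bottomE _) = a
  label (topE _)    = a
  label leftE       = b
  label (rightE _)  = b
  label exitE       = c

  -- Labels enter as equations, since an index `label e` would obstruct matching on cells.
  data Cells (T : Set) : ∀ {n} → Vec A n → Set where
    vertex : Vertex → Cells T []
    edge   : ∀ {x} (e : Edge T) → label e ≡ x → Cells T (x ∷ [])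
    square : ∀ {x y} → Square → a ≡ x → b ≡ y → Cells T (x ∷ y ∷ [])

  module _ (rights : RightEdges) where
    open RightEdges rights

    endpointE : Endpoint → Edge Right → Vertex
    endpointE 𝟎 (bottomE _) = origin
    endpointE 𝟎 (topE _)    = afterB
    endpointE 𝟎 leftE       = origin
    endpointE 𝟎 (rightE g)  = afterA (foot g)
    endpointE 𝟎 exitE       = afterA s₂
    endpointE 𝟏 (bottomE s) = afterA s
    endpointE 𝟏 (topE _)    = final
    endpointE 𝟏 leftE       = afterB
    endpointE 𝟏 (rightE _)  = final
    endpointE 𝟏 exitE       = exited

    side-a side-b : Endpoint → Square → Edge Right
    side-a 𝟎 q = bottomE (bottom q)
    side-a 𝟏 q = topE (top q)
    side-b 𝟎 q = leftE
    side-b 𝟏 q = rightE (right q)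

    side-a-label : ∀ k q → label (side-a k q) ≡ a
    side-a-label 𝟎 q = refl
    side-a-label 𝟏 q = refl

    side-b-label : ∀ k q → label (side-b k q) ≡ b
    side-b-label 𝟎 q = refl
    side-b-label 𝟏 q = refl

    corner : ∀ k k′ q → endpointE k (side-a k′ q) ≡ endpointE k′ (side-b k q)
    corner 𝟎 𝟎 q = refl
    corner 𝟎 𝟏 q = refl
    -- The corner reached when `a` has ended and `b` has not started is the only one that depends on
    -- the right edges.
    corner 𝟏 𝟎 q = cong afterA (sym (foot-right q))
    corner 𝟏 𝟏 q = refl

    restrict : {U : Vec A m} {V : Vec A n} → Face U V → Cells Right V → Cells Right U
    restrict []                    x                = x
    restrict (keep [])             x                = x
    restrict (fix k [])            (edge e _)       = vertex (endpointE k e)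
    restrict (keep (keep []))      x                = x
    restrict (keep (fix k []))     (square q a≡ _)  =
      edge (side-a k q) (trans (side-a-label k q) a≡)
    restrict (fix k (keep []))     (square q _ b≡)  =
      edge (side-b k q) (trans (side-b-label k q) b≡)
    restrict (fix k (fix k′ []))   (square q _ _)   =
      vertex (endpointE k (side-a k′ q))

    restrict-id : {U : Vec A n} → ∀ x → restrict (idᶠ U) x ≡ x
    restrict-id (vertex _)     = refl
    restrict-id (edge _ _)     = refl
    restrict-id (square _ _ _) = refl

    restrict-∘ : {U : Vec A l} {V : Vec A m} {W : Vec A n} (w : Face V W) (w′ : Face U V) →
                 ∀ x → restrict (w ∘ᶠ w′) x ≡ restrict w′ (restrict w x)
    restrict-∘ []                  []                  x              = refl
    restrict-∘ (keep [])           (keep [])           x              = refl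
    restrict-∘ (keep [])           (fix _ [])          x              = refl
    restrict-∘ (fix _ [])          []                  x              = refl
    restrict-∘ (keep (keep []))    (keep (keep []))    x              = refl
    restrict-∘ (keep (keep []))    (keep (fix _ []))   x              = refl
    restrict-∘ (keep (keep []))    (fix _ (keep []))   x              = refl
    restrict-∘ (keep (keep []))    (fix _ (fix _ []))  x              = refl
    restrict-∘ (keep (fix _ []))   (keep [])           x              = refl
    restrict-∘ (keep (fix _ []))   (fix _ [])          (square _ _ _) = refl
    restrict-∘ (fix _ (keep []))   (keep [])           x              = refl
    -- `restrict` reads a corner off the `a`-edge, so `corner` enters only on the way through the
    -- `b`-edge.
    restrict-∘ (fix k (keep []))   (fix k′ [])         (square q _ _) =
      cong vertex (corner k k′ q)
    restrict-∘ (fix _ (fix _ []))  []                  x              = refl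

    example : HDA A
    example = record
      { precubicalSet = FacePresheaf.toPrecubicalSet (record
          { Cells       = Cells Right
          ; restrict    = restrict
          ; restrict-id = restrict-id
          ; restrict-∘  = restrict-∘
          })
      ; initial = vertex origin
      }

    -- Only squares have two events. With equal endpoints only the corners `origin` and `final`
    -- arise, and these compute along either edge.
    example-commuting : Commuting example
    example-commuting 𝟎 (square _ _ _) {zero} {suc zero} {zero} {zero} _ _ _ = refl
    example-commuting 𝟏 (square _ _ _) {zero} {suc zero} {zero} {zero} _ _ _ = refl

  -- Similar cells in two members of the family.

  module _ (rights₁ rights₂ : RightEdges) (_≈ₜ_ : Rel Top 0ℓ) where
    private
      module R₁ = RightEdges rights₁
      module R₂ = RightEdges rights₂

    data SimilarEdges : Edge R₁.Right → Edge R₂.Right → Set where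
      bottomE : ∀ {s} → SimilarEdges (bottomE s) (bottomE s)
      topE    : ∀ {e e′} → e ≈ₜ e′ → SimilarEdges (topE e) (topE e′)
      leftE   : SimilarEdges leftE leftE
      rightE  : ∀ {g g′} → R₁.foot g ≡ R₂.foot g′ → SimilarEdges (rightE g) (rightE g′)
      exitE   : SimilarEdges exitE exitE

    -- Squares are compared by their bottom edges, which decide whether `c` becomes possible after
    -- going back; `q₁` and `q₂` are therefore similar in spite of their different top edges.
    data Similar : CellRelation (example rights₁) (example rights₂) where
      vertex : ∀ {x} → Similar (vertex x) (vertex x)
      edge   : ∀ {e e′ x} {p : label e ≡ x} {p′ : label e′ ≡ x} →
               SimilarEdges e e′ → Similar (edge e p) (edge e′ p′)
      square : ∀ {q q′ x y} {a≡ a≡′ : a ≡ x} {b≡ b≡′ : b ≡ y} →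
               bottom q ≡ bottom q′ → Similar (square q a≡ b≡) (square q′ a≡′ b≡′)

  module _ (rights₁ rights₂ : RightEdges) where
    private
      module R₁ = RightEdges rights₁
      module R₂ = RightEdges rights₂

    -- A path that enters a top edge by ending b has chosen its square before, and
    -- the other squares over that edge can no longer be seen; so _~_ ignores which
    -- top edge it is.
    _~_ _≃_ : CellRelation (example rights₁) (example rights₂)
    _~_ = Similar rights₁ rights₂ (λ _ _ → ⊤)
    _≃_ = Similar rights₁ rights₂ _≡_

    ≃⇒~ : {U : Vec A n} {x : Cells R₁.Right U} {y : Cells R₂.Right U} → x ≃ y → x ~ y
    ≃⇒~ vertex             = vertex
    ≃⇒~ (edge bottomE)     = edge bottomE
    ≃⇒~ (edge (topE _))    = edge (topE tt)
    ≃⇒~ (edge leftE)       = edge leftE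
    ≃⇒~ (edge (rightE eq)) = edge (rightE eq)
    ≃⇒~ (edge exitE)       = edge exitE
    ≃⇒~ (square eq)        = square eq

    local : IsLocalSimulation (example rights₁) (example rights₂) _~_ _≃_
    local = record
      { ~-initial = vertex
      ; ≃⇒~       = ≃⇒~
      ; ~-δ𝟏      = ~-δ𝟏
      ; ≃-δ𝟎      = ≃-δ𝟎
      ; ~-lift    = ~-lift
      ; ~-fill    = ~-fill
      }
      where
      module X = HDA (example rights₁)
      module Y = HDA (example rights₂)

      ~-δ𝟏 : {V : Vec A (suc n)} {x : X.Cells V} {y : Y.Cells V} (i : Fin (suc n)) →
             x ~ y → X.δ 𝟏 i x ~ Y.δ 𝟏 i y
      ~-δ𝟏 zero (edge bottomE)    = vertex
      ~-δ𝟏 zero (edge (topE _))   = vertex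
      ~-δ𝟏 zero (edge leftE)      = vertex
      ~-δ𝟏 zero (edge (rightE _)) = vertex
      ~-δ𝟏 zero (edge exitE)      = vertex
      ~-δ𝟏 zero (square {q} {q′} eq) =
        edge (rightE (trans (R₁.foot-right q) (trans eq (sym (R₂.foot-right q′)))))
      ~-δ𝟏 (suc zero) (square eq) = edge (topE tt)

      ≃-δ𝟎 : {V : Vec A (suc n)} {x : X.Cells V} {y : Y.Cells V} (i : Fin (suc n)) →
             x ≃ y → X.δ 𝟎 i x ≃ Y.δ 𝟎 i y
      ≃-δ𝟎 zero (edge bottomE)  = vertex
      ≃-δ𝟎 zero (edge (topE _)) = vertex
      ≃-δ𝟎 zero (edge leftE)    = vertex
      ≃-δ𝟎 zero (edge exitE)    = vertex
      ≃-δ𝟎 zero (square _)      = edge leftE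
      ≃-δ𝟎 zero       (edge (rightE eq)) rewrite eq = vertex
      ≃-δ𝟎 (suc zero) (square eq)        rewrite eq = edge bottomE

      foot-right-filler : ∀ g → R₂.foot g ≡ bottom (R₂.filler g)
      foot-right-filler g = trans (cong R₂.foot (sym (R₂.right-filler g))) (R₂.foot-right _)

      ~-lift : {V : Vec A (suc n)} (i : Fin (suc n)) (x : X.Cells V)
               {y : Y.Cells (removeAt V i)} → X.δ 𝟎 i x ~ y →
               ∃ λ y⁺ → x ≃ y⁺ × Y.δ 𝟎 i y⁺ ≡ y
      ~-lift zero (edge (bottomE s) p) vertex = edge (bottomE s) p , edge bottomE , refl
      ~-lift zero (edge (topE e) p)    vertex = edge (topE e) p , edge (topE refl) , refl
      ~-lift zero (edge leftE p)       vertex = edge leftE p , edge leftE , refl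
      ~-lift zero (edge exitE p)       vertex = edge exitE p , edge exitE , refl
      -- Any right edge with the same foot will do; one is found by passing through a square at `g`.
      ~-lift zero (edge (rightE g) p)  vertex =
        edge (rightE g′) p , edge (rightE (sym foot≡)) , cong (λ s → vertex (afterA s)) foot≡
        where
        q = R₁.filler g
        g′ = R₂.right q
        foot≡ : R₂.foot g′ ≡ R₁.foot g
        foot≡ = trans (R₂.foot-right q)
                      (trans (sym (R₁.foot-right q)) (cong R₁.foot (R₁.right-filler g)))
      ~-lift zero (square q refl refl) (edge {p′ = refl} leftE) =
        square q refl refl , square refl , refl
      ~-lift (suc zero) (square q refl refl) (edge {p′ = refl} bottomE) =
        square q refl refl , square refl , refl

      -- If `a` has ended, the square is taken at the given right edge, and equal feet make the
      -- bottom edges agree. If `b` has ended, `_≃_` provides the same top edge on both sides, and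
      -- the same square fits.
      ~-fill : {V : Vec A (suc (suc n))} (i j : Fin (suc (suc n))) (x : X.Cells V)
               {y : Y.Cells (removeAt V i)} {z : Y.Cells (removeAt V j)} →
               X.δ 𝟎 i x ~ y → X.δ 𝟏 j x ≃ z →
               ∃ λ w → x ≃ w × Y.δ 𝟎 i w ≡ y × Y.δ 𝟏 j w ≡ z
      ~-fill i zero (square q refl refl) y~ (edge {e′ = rightE g} {p′ = refl} (rightE eq)) =
        fill i y~
        where
        q′ = R₂.filler g
        bottom≡ : bottom q ≡ bottom q′
        bottom≡ = trans (sym (R₁.foot-right q)) (trans eq (foot-right-filler g))
        right≡ : _≡_ {A = Y.Cells (b ∷ [])} (edge (rightE (R₂.right q′)) refl) (edge (rightE g) refl)
        right≡ = cong (λ g → edge (rightE g) refl) (R₂.right-filler g)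
        fill : ∀ i {y} → X.δ 𝟎 i (square q refl refl) ~ y →
               ∃ λ w → square q refl refl ≃ w × Y.δ 𝟎 i w ≡ y × Y.δ 𝟏 zero w ≡ edge (rightE g) refl
        fill zero       (edge {p′ = refl} leftE)   =
          square q′ refl refl , square bottom≡ , refl , right≡
        fill (suc zero) (edge {p′ = refl} bottomE) =
          square q′ refl refl , square bottom≡
            , cong (λ s → edge (bottomE s) refl) (sym bottom≡) , right≡
      ~-fill zero (suc zero) (square q refl refl)
             (edge {p′ = refl} leftE) (edge {p′ = refl} (topE refl)) =
        square q refl refl , square refl , refl , refl
      ~-fill (suc zero) (suc zero) (square q refl refl)
             (edge {p′ = refl} bottomE) (edge {p′ = refl} (topE refl)) =
        square q refl refl , square refl , refl , refl

-- The HDAs `𝒴` and `𝒵` and their hqhp-bisimilarity.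

bottomRights squareRights : RightEdges
bottomRights = record
  { Right        = Bottom
  ; right        = bottom
  ; foot         = id
  ; foot-right   = λ _ → refl
  -- For `s₁` the square `q₂` would do as well.
  ; filler       = λ { s₁ → q₁ ; s₂ → q₃ }
  ; right-filler = λ { s₁ → refl ; s₂ → refl }
  }
squareRights = record
  { Right        = Square
  ; right        = id
  ; foot         = bottom
  ; foot-right   = λ _ → refl
  ; filler       = id
  ; right-filler = λ _ → refl
  }

module Counterexample {A : Set} (a b c : A) (a≢b : a ≢ b) (a≢c : a ≢ c) (b≢c : b ≢ c) where
  open Example a b c

  𝒴 𝒵 : HDA A
  𝒴 = example bottomRights
  𝒵 = example squareRights

  Similar-sym : ∀ {rights₁ rights₂ n} {U : Vec A n}
    {x : Cells (RightEdges.Right rights₁) U} {y : Cells (RightEdges.Right rights₂) U} →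
    Similar rights₁ rights₂ _≡_ x y → Similar rights₂ rights₁ _≡_ y x
  Similar-sym vertex             = vertex
  Similar-sym (edge bottomE)     = edge bottomE
  Similar-sym (edge (topE eq))   = edge (topE (sym eq))
  Similar-sym (edge leftE)       = edge leftE
  Similar-sym (edge (rightE eq)) = edge (rightE (sym eq))
  Similar-sym (edge exitE)       = edge exitE
  Similar-sym (square eq)        = square (sym eq)

  hqhp-bisimilar : Bisimilar hqhp 𝒴 𝒵
  hqhp-bisimilar = (λ (_ , α) (_ , β) → Related 𝒴 𝒵 (_≃_ bottomRights squareRights) α β) , record
    { forth = LocalSimulation.simulation
        (local bottomRights squareRights) (example-commuting squareRights)
    ; back  = IsSimulation-resp (Related-sym Similar-sym) (Related-sym Similar-sym)
        (LocalSimulation.simulation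
          (local squareRights bottomRights) (example-commuting bottomRights))
    }

  -- Paths determined by their ST-traces.

  ∷ʳ≢[] : {B : Set} {xs : List B} {x : B} → xs ∷ʳ x ≢ []
  ∷ʳ≢[] {xs = xs} eq with () ← ++-conicalʳ xs _ eq

  module _ (rights : RightEdges) where
    open RightEdges rights
    private X = example rights

    bottomCell : Bottom → HDA.Cells X (a ∷ [])
    bottomCell s = edge (bottomE s) refl

    topCell : Top → HDA.Cells X (a ∷ [])
    topCell e = edge (topE e) refl

    leftCell : HDA.Cells X (b ∷ [])
    leftCell = edge leftE refl

    rightCell : Right → HDA.Cells X (b ∷ [])
    rightCell g = edge (rightE g) refl

    squareCell : Square → HDA.Cells X (a ∷ b ∷ [])
    squareCell q = square q refl refl

    startBA : ∀ q → PathTo X ⟨ squareCell q ⟩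
    startBA q = root ▸ up zero leftCell refl ▸ up zero (squareCell q) refl

    startAB : ∀ q → PathTo X ⟨ squareCell q ⟩
    startAB q = root ▸ up zero (bottomCell (bottom q)) refl ▸ up (suc zero) (squareCell q) refl

    endAB : ∀ {q} → PathTo X ⟨ squareCell q ⟩ → PathTo X ⟨ vertex final ⟩
    endAB {q} α = α ▸ down zero (squareCell q) refl ▸ down zero (rightCell (right q)) refl

    endBA : ∀ {q} → PathTo X ⟨ squareCell q ⟩ → PathTo X ⟨ vertex final ⟩
    endBA {q} α = α ▸ down (suc zero) (squareCell q) refl ▸ down zero (topCell (top q)) refl

    -- Among the edges that start in `origin` only `leftE` is labelled `b`, and it is a lower face
    -- of squares only, at position `zero`.
    second-start-inversion : ∀ {x} {V : Vec A (suc n)} (y : HDA.Cells X (x ∷ [])) p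
      (i : Fin (suc n)) (y′ : HDA.Cells X V) (p′ : ⟨ y ⟩ ≡ ⟨ HDA.δ X 𝟎 i y′ ⟩) →
      x ≡ b → lookup V i ≡ a →
      ∃ λ q → _≡_ {A = Path X} (_ , root ▸ up zero y p ▸ up i y′ p′) (_ , startBA q)
    second-start-inversion (edge (bottomE _) a≡x) p i y′ p′ x≡b _ = contradiction (trans a≡x x≡b) a≢b
    second-start-inversion (edge (topE _) _) ()
    second-start-inversion (edge (rightE _) _) ()
    second-start-inversion (edge exitE _) ()
    second-start-inversion (edge leftE refl) refl zero (square q refl refl) refl _ _ = q , refl
    second-start-inversion (edge leftE refl) refl (suc zero) (square q refl refl) () _ _

    startBA-inversion : ∀ {c} (α : PathTo X c) → ST α ≡ (b ⁺) ∷ (a ⁺) ∷ [] →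
                        ∃ λ q → _≡_ {A = Path X} (c , α) (_ , startBA q)
    startBA-inversion (ρ ▸ down _ _ _) eq with () ← ∷ʳ-injectiveʳ (ST ρ) ((b ⁺) ∷ []) eq
    startBA-inversion (root ▸ up _ _ _) ()
    startBA-inversion (ρ ▸ down _ _ _ ▸ up _ _ _) eq
      with () ← ∷ʳ-injectiveʳ (ST ρ) [] (∷ʳ-injectiveˡ _ ((b ⁺) ∷ []) eq)
    startBA-inversion (ρ ▸ up {V = V} i x p ▸ up j y q) eq
      with eq′ ← ∷ʳ-injectiveˡ _ ((b ⁺) ∷ []) eq | refl ← ∷ʳ-injectiveʳ (ST ρ ∷ʳ _) ((b ⁺) ∷ []) eq
      with ρ | ∷ʳ-injectiveˡ (ST ρ) [] eq′ | V | i | x | p | ∷ʳ-injectiveʳ (ST ρ) [] eq′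
    ... | ρ ▸ up _ _ _   | STρ≡[] | _ | _ | _ | _ | _ = contradiction STρ≡[] ∷ʳ≢[]
    ... | ρ ▸ down _ _ _ | STρ≡[] | _ | _ | _ | _ | _ = contradiction STρ≡[] ∷ʳ≢[]
    -- `V` is a singleton because, by `p`, removing one event leads to the initial cell of dimension
    -- 0.
    ... | root           | _      | _ ∷ [] | zero | x | p | refl = second-start-inversion x p j y q refl refl

  -- Walks between the squares of `𝒴`.

  private Y = bottomRights

  _↝*_ : Rel (Path 𝒴) 0ℓ
  _↝*_ = Star Move

  -- The first half of a name is the order of the starts, the second that of the ends.
  ba-ab ab-ab ba-ba : Square → Path 𝒴
  ba-ab q = _ , endAB Y (startBA Y q)
  ab-ab q = _ , endAB Y (startAB Y q)
  ba-ba q = _ , endBA Y (startBA Y q)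

  a-then-b : Bottom → Path 𝒴
  a-then-b s = _ , root ▸ up zero (bottomCell Y s) refl ▸ down zero (bottomCell Y s) refl
                        ▸ up zero (rightCell Y s) refl ▸ down zero (rightCell Y s) refl

  b-then-a : Top → Path 𝒴
  b-then-a e = _ , root ▸ up zero (leftCell Y) refl ▸ down zero (leftCell Y) refl
                        ▸ up zero (topCell Y e) refl ▸ down zero (topCell Y e) refl

  ba-ab⇆ab-ab : ∀ q → ab-ab q ⇆[ 1 ] ba-ab q
  ba-ab⇆ab-ab q = fwd (there (there (here (up-up (s≤s z≤n)))))

  ba-ba⇆ba-ab : ∀ q → ba-ba q ⇆[ 3 ] ba-ab q
  ba-ba⇆ba-ab q = fwd (here (down-down (s≤s z≤n)))

  a-then-b⊑ab-ab : ∀ q → a-then-b (bottom q) ⊑[ 2 ] ab-ab q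
  a-then-b⊑ab-ab q = there (here (end-smaller (s≤s z≤n)))

  b-then-a⊑ba-ba : ∀ q → b-then-a (top q) ⊑[ 2 ] ba-ba q
  b-then-a⊑ba-ba q = there (here (end-larger (s≤s z≤n)))

  -- In `𝒴` the right edge, and with it `a-then-b`, depends on the bottom edge alone, so one
  -- serialisation belongs to both squares. This is the passage from `q₁` to `q₂` that `𝒵` lacks.
  exchange-bottom : ∀ q q′ → bottom q ≡ bottom q′ → ba-ab q ↝* ba-ab q′
  exchange-bottom q q′ eq =
      swap (ba-ab⇆ab-ab q)
    ◅ serialise (a-then-b⊑ab-ab q)
    ◅ parallelise (subst (λ s → a-then-b s ⊑[ 2 ] ab-ab q′) (sym eq) (a-then-b⊑ab-ab q′))
    ◅ swap (symmetric _ (ba-ab⇆ab-ab q′))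
    ◅ done

  exchange-top : ∀ q q′ → top q ≡ top q′ → ba-ab q ↝* ba-ab q′
  exchange-top q q′ eq =
      swap (ba-ba⇆ba-ab q)
    ◅ serialise (b-then-a⊑ba-ba q)
    ◅ parallelise (subst (λ s → b-then-a s ⊑[ 2 ] ba-ba q′) (sym eq) (b-then-a⊑ba-ba q′))
    ◅ swap (symmetric _ (ba-ba⇆ba-ab q′))
    ◅ done

  connected : ∀ q → ba-ab q ↝* ba-ab q₃
  connected q₁ = exchange-bottom q₁ q₂ refl ◅◅ exchange-top q₂ q₃ refl
  connected q₂ = exchange-top q₂ q₃ refl
  connected q₃ = done

  start-s₂ exit-s₂ : Path 𝒴
  start-s₂ = _ , root ▸ up zero (bottomCell Y s₂) refl
  exit-s₂ = _ , root ▸ up zero (bottomCell Y s₂) refl ▸ down zero (bottomCell Y s₂) refl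
                   ▸ up zero (edge exitE refl) refl

  exits : start-s₂ ↪ exit-s₂
  exits = more (more stop)

  reaches-s₂ : ∀ q → ba-ab q ↝* start-s₂
  -- Retracting three of the four steps of `ab-ab q₃` leaves the start of `a` on `bottomE s₂`.
  reaches-s₂ q = connected q ◅◅ swap (ba-ab⇆ab-ab q₃) ◅ retract (more (more (more stop))) ◅ done

  -- Confinement to `q₁` in `𝒵`.

  -- The faces of q₁ in 𝒵.
  data Inside : {U : Vec A n} → HDA.Cells 𝒵 U → Set where
    origin  : Inside (vertex origin)
    afterA  : Inside (vertex (afterA s₁))
    afterB  : Inside (vertex afterB)
    final   : Inside (vertex final)
    bottomE : ∀ {x} {p : a ≡ x} → Inside (edge (bottomE s₁) p)
    topE    : ∀ {x} {p : a ≡ x} → Inside (edge (topE e₁) p)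
    leftE   : ∀ {x} {p : b ≡ x} → Inside (edge leftE p)
    rightE  : ∀ {x} {p : b ≡ x} → Inside (edge (rightE q₁) p)
    square  : ∀ {x y} {p : a ≡ x} {p′ : b ≡ y} → Inside (square q₁ p p′)

  InsideCell : Cell 𝒵 → Set
  InsideCell x = Inside (Cell.cell x)

  Inside-δ : ∀ k {V : Vec A (suc n)} {x : HDA.Cells 𝒵 V} i → Inside x → Inside (HDA.δ 𝒵 k i x)
  Inside-δ 𝟎 zero       bottomE = origin
  Inside-δ 𝟏 zero       bottomE = afterA
  Inside-δ 𝟎 zero       topE    = afterB
  Inside-δ 𝟏 zero       topE    = final
  Inside-δ 𝟎 zero       leftE   = origin
  Inside-δ 𝟏 zero       leftE   = afterB
  Inside-δ 𝟎 zero       rightE  = afterA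
  Inside-δ 𝟏 zero       rightE  = final
  Inside-δ 𝟎 zero       square  = leftE
  Inside-δ 𝟏 zero       square  = rightE
  Inside-δ 𝟎 (suc zero) square  = bottomE
  Inside-δ 𝟏 (suc zero) square  = topE

  -- The edges `e₁` and `rightE q₁` bound no other square. In `𝒴` this fails for the right edge of
  -- `q₁`, which also bounds `q₂`.
  Inside-fill : {V : Vec A (suc (suc n))} (x : HDA.Cells 𝒵 V) (i : Fin (suc (suc n))) →
                Inside (HDA.δ 𝒵 𝟏 i x) → Inside x
  Inside-fill (square q₁ _ _) i          _  = square
  Inside-fill (square q₂ _ _) zero       ()
  Inside-fill (square q₂ _ _) (suc zero) ()
  Inside-fill (square q₃ _ _) zero       ()
  Inside-fill (square q₃ _ _) (suc zero) ()

  data Confined : ∀ {c} → PathTo 𝒵 c → Set where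
    root : Confined root
    _▸_  : ∀ {c c′} {α : PathTo 𝒵 c} {s : Step 𝒵 c c′} →
           Confined α → InsideCell c′ → Confined (α ▸ s)

  Confined-end : ∀ {c} {α : PathTo 𝒵 c} → Confined α → InsideCell c
  Confined-end root    = origin
  Confined-end (_ ▸ i) = i

  Confined-prefix : ∀ {α β : Path 𝒵} → α ↪ β → Confined (proj₂ β) → Confined (proj₂ α)
  Confined-prefix stop     κ       = κ
  Confined-prefix (more e) (κ ▸ _) = Confined-prefix e κ

  -- If the old pair of steps begins with an end, the cell before it has an event, so a cell newly
  -- inserted by a start has at least two and `Inside-fill` applies. An inserted edge could escape:
  -- `topE e₂` also ends in `final`.
  EndsFirst : Rel (Label × Label) 0ℓ → Set
  EndsFirst P = ∀ {l₁ l₂ i j} → P (l₁ , l₂) (dˡ 𝟎 i , dˡ 𝟏 j) → endpoint l₁ ≡ 𝟏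

  -- The new middle cell is a face of a neighbour unless it is entered by a start and left by an
  -- end; that case is where `EndsFirst` is needed.
  Inside-replace : ∀ {P} → EndsFirst P → ∀ {b d d′ e} {s : Step 𝒵 b d} {t : Step 𝒵 d e}
    (s′ : Step 𝒵 b d′) (t′ : Step 𝒵 d′ e) →
    P (stepLabel s , stepLabel t) (stepLabel s′ , stepLabel t′) →
    InsideCell b → InsideCell e → InsideCell d′
  Inside-replace _ (down i x refl) _ _ ιb _ = Inside-δ 𝟏 i ιb
  Inside-replace _ (up _ _ _) (up i x refl) _ _ ιe = Inside-δ 𝟎 i ιe
  Inside-replace ef {s = up _ _ _} (up _ _ _) (down _ _ _) p with () ← ef p
  Inside-replace _ {s = down _ _ _} (up _ x refl) (down j _ refl) _ _ ιe = Inside-fill x j ιe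

  Confined-Replace : ∀ {P ℓ} {α β : Path 𝒵} → EndsFirst P → Replace P ℓ α β →
                     Confined (proj₂ α) → Confined (proj₂ β)
  Confined-Replace {P = P} ef (here {s = s} {t} {s′} {t′} p) (κ ▸ _ ▸ ιe) =
    κ ▸ Inside-replace {P} ef {s = s} {t} s′ t′ p (Confined-end κ) ιe ▸ ιe
  Confined-Replace {P = P} ef (there R) (κ ▸ ι) = Confined-Replace {P = P} ef R κ ▸ ι

  Confined-Move : ∀ {α β : Path 𝒵} → Move α β → Confined (proj₂ α) → Confined (proj₂ β)
  Confined-Move (retract e)     = Confined-prefix e
  Confined-Move (parallelise R) =
    Confined-Replace (λ { (end-larger _) → refl ; (end-smaller _) → refl }) R
  -- Serialising and swapping never produce a start followed by an end, so `EndsFirst` holds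
  -- vacuously.
  Confined-Move (serialise R)   = Confined-Replace (λ ()) (Replace-flip R)
  Confined-Move (swap (fwd R))  = Confined-Replace (λ ()) (Replace-flip R)
  Confined-Move (swap (bwd R))  = Confined-Replace (λ ()) R

  Confined-Moves : ∀ {α β : Path 𝒵} → Star Move α β → Confined (proj₂ α) → Confined (proj₂ β)
  Confined-Moves done     κ = κ
  Confined-Moves (m ◅ ms) κ = Confined-Moves ms (Confined-Move m κ)

  -- The part of Inside that no step leaves; from afterB, say, a path may go to e₂.
  data Late : {U : Vec A n} → HDA.Cells 𝒵 U → Set where
    square : ∀ {x y} {p : a ≡ x} {p′ : b ≡ y} → Late (square q₁ p p′)
    topE   : ∀ {x} {p : a ≡ x} → Late (edge (topE e₁) p)
    rightE : ∀ {x} {p : b ≡ x} → Late (edge (rightE q₁) p)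
    final  : Late (vertex final)

  Late⇒Inside : {U : Vec A n} {x : HDA.Cells 𝒵 U} → Late x → Inside x
  Late⇒Inside square = square
  Late⇒Inside topE   = topE
  Late⇒Inside rightE = rightE
  Late⇒Inside final  = final

  Late-step : ∀ {c c′} → Step 𝒵 c c′ → Late (Cell.cell c) → Late (Cell.cell c′)
  Late-step (up zero (edge (bottomE _) _) refl) ()
  Late-step (up zero (edge (topE _) _) refl) ()
  Late-step (up zero (edge leftE _) refl) ()
  Late-step (up zero (edge (rightE _) _) refl) ()
  Late-step (up zero (edge exitE _) refl) ()
  Late-step (up zero (square _ _ _) refl) ()
  Late-step (up (suc zero) (square _ _ _) refl) ()
  Late-step (down zero _ refl) square = rightE
  Late-step (down (suc zero) _ refl) square = topE
  Late-step (down zero _ refl) topE = final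
  Late-step (down zero _ refl) rightE = final

  -- An extension in `𝒵` is chosen by the bisimulation; from the square `q₁` every choice remains
  -- among its faces.
  Late-extension : ∀ {α β : Path 𝒵} → α ↪ β → Confined (proj₂ α) → Late (Cell.cell (proj₁ α)) →
                   Confined (proj₂ β) × Late (Cell.cell (proj₁ β))
  Late-extension stop κ λα = κ , λα
  Late-extension (more {s = s} e) κ λα =
    let κ′ , λβ = Late-extension e κ λα ; λ′ = Late-step s λβ in κ′ ▸ Late⇒Inside λ′ , λ′

  -- Confined prefixes of paths that start `c`.

  prefix-inside : ∀ {c c′} {α : Path 𝒵} {β : PathTo 𝒵 c} {s : Step 𝒵 c c′} →
                  ¬ InsideCell c′ → Confined (proj₂ α) → α ↪ (c′ , β ▸ s) → α ↪ (c , β)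
  prefix-inside ∉ κ stop     = contradiction (Confined-end κ) ∉
  prefix-inside ∉ κ (more e) = e

  module _ {α : Path 𝒵} (κ : Confined (proj₂ α)) where

    before-origin : (ρ : PathTo 𝒵 ⟨ vertex origin ⟩) → α ↪ (_ , ρ) → α ≡ empty
    before-origin root stop = refl
    before-origin (_ ▸ down zero (edge (bottomE _) _) ())
    before-origin (_ ▸ down zero (edge (topE _) _) ())
    before-origin (_ ▸ down zero (edge leftE _) ())
    before-origin (_ ▸ down zero (edge (rightE _) _) ())
    before-origin (_ ▸ down zero (edge exitE _) ())

    before-s₂ : ∀ {x p} (ρ : PathTo 𝒵 ⟨ edge {x = x} (bottomE s₂) p ⟩) → α ↪ (_ , ρ) → α ≡ empty
    before-s₂ (ρ ▸ up zero _ refl) e = before-origin ρ (prefix-inside (λ ()) κ e)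
    before-s₂ (_ ▸ down zero (square _ _ _) ())
    before-s₂ (_ ▸ down (suc zero) (square _ _ _) ())

    before-afterA-s₂ : (ρ : PathTo 𝒵 ⟨ vertex (afterA s₂) ⟩) → α ↪ (_ , ρ) → α ≡ empty
    before-afterA-s₂ (ρ ▸ down zero (edge (bottomE s₂) _) refl) e =
      before-s₂ ρ (prefix-inside (λ ()) κ e)

    -- Only `exitE` starts `c`, and it is reached only from `origin` through `bottomE s₂` and
    -- `afterA s₂`. Of these only `origin` lies in `q₁`, so a confined prefix cannot get past the
    -- root.
    before-exit : ∀ {x} σ (ρ : PathTo 𝒵 x) → ST ρ ≡ σ ∷ʳ (c ⁺) → α ↪ (_ , ρ) → α ≡ empty
    before-exit σ root eq _ = contradiction (sym eq) ∷ʳ≢[]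
    before-exit σ (ρ ▸ down _ _ _) eq _ with () ← ∷ʳ-injectiveʳ (ST ρ) σ eq
    before-exit σ (ρ ▸ up i x p) eq _ with ∷ʳ-injectiveʳ (ST ρ) σ eq
    before-exit σ (ρ ▸ up zero (edge (bottomE _) refl) _) _ _ | refl = contradiction refl a≢c
    before-exit σ (ρ ▸ up zero (edge (topE _) refl) _) _ _ | refl = contradiction refl a≢c
    before-exit σ (ρ ▸ up zero (edge leftE refl) _) _ _ | refl = contradiction refl b≢c
    before-exit σ (ρ ▸ up zero (edge (rightE _) refl) _) _ _ | refl = contradiction refl b≢c
    before-exit σ (ρ ▸ up zero (square _ refl refl) _) _ _ | refl = contradiction refl a≢c
    before-exit σ (ρ ▸ up (suc zero) (square _ refl refl) _) _ _ | refl = contradiction refl b≢c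
    before-exit σ (ρ ▸ up zero (edge exitE refl) refl) _ e | _ =
      before-afterA-s₂ ρ (prefix-inside (λ ()) κ e)

  empty-↪ : {X : HDA A} {c : Cell X} (α : PathTo X c) → empty ↪ (c , α)
  empty-↪ root    = stop
  empty-↪ (α ▸ _) = more (empty-↪ α)

  -- The first path is chosen in `𝒵`, which fixes the square `q₁` there. The answer in `𝒴` may lie
  -- in any square, hence `connected` starts from all three.
  not-hhp-bisimilar : ¬ Bisimilar hhp 𝒴 𝒵
  not-hhp-bisimilar (R , bisim) =
    let open IsBisimulation bisim
        open IsSimulation forth using (ST-equal; extension)
        β₀ = _ , startBA squareRights q₁
        (_ , α) , _ , αRβ₀ = IsSimulation.extension back (IsSimulation.related-empty back)
                                                    (empty-↪ (proj₂ β₀))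
        q , α≡ = startBA-inversion bottomRights α (ST-equal αRβ₀)
        -- The path in `𝒴` is prolonged by the two ends to `ba-ab q`, where `reaches-s₂` begins.
        _ , e , r = extension (subst (λ α → R α β₀) α≡ αRβ₀) (more (more stop))
        κ , _ = Late-extension e (root ▸ leftE ▸ square) square
        _ , moves , r′ = Moves-transfers forth r (reaches-s₂ q)
        _ , e′ , r″ = extension r′ exits
        -- The list is the trace of `exit-s₂` without its last entry; `a` started at step 1.
        β≡empty = before-exit (Confined-Moves moves κ) ((a ⁺) ∷ (a ^ 1) ∷ []) _
                              (sym (ST-equal r″)) e′
    -- The path related to `start-s₂` would be empty, but the trace of `start-s₂` has one entry.
    in contradiction (subst (λ β → ST (proj₂ start-s₂) ≡ ST (proj₂ β)) β≡empty (ST-equal r′))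
                     λ ()

theorem5p15 : (Act : Set) (a b c d : Act) → Unique (a ∷ b ∷ c ∷ d ∷ []) →
    (∀ (Y Z : HDA Act) → Bisimilar hhp Y Z → Bisimilar hqhp Y Z) ×
    (∃[ Y ] ∃[ Z ] (Bisimilar {Act} hqhp Y Z × ¬ Bisimilar {Act} hhp Y Z))
theorem5p15 Act a b c d ((a≢b ∷ a≢c ∷ _) ∷ (b≢c ∷ _) ∷ _) =
  (λ _ _ → hhp⇒hqhp) , 𝒴 , 𝒵 , hqhp-bisimilar , not-hhp-bisimilar
  where open Counterexample a b c a≢b a≢c b≢c
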